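{- Let $B$ be an infinite punctual Boolean algebra which is relatively computably categorical. Then $\mathrm{PrCat}(B)=\mathrm{Cone}(\Delta^0_1)$.
   Context: Boolean algebras are considered as structures in the language of join, meet, complement, top and bottom. A structure is punctual if its domain is $\omega$ and its functions and relations are uniformly primitive recursive. A computable structure $A$ is relatively computably categorical if for every copy $C\cong A$ with domain $\omega$ there is an isomorphism $f:C\to A$ computable relative to the atomic diagram of $C$. For total $f,g:\omega\to\omega$, write $f\le_{PR}g$ if $f$ is primitive recursive relative to $g$; the induced equivalence classes are PR-degrees, and $f\le_{PR}\mathbf d$ means $f\le_{PR}$ a member of $\mathbf d$. For a punctual structure $A$, $\mathrm{PrCat}(A)$ is the set of PR-degrees $\mathbf d$ such that for every punctual $C\cong A$ there is an isomorphism $f:A\to C$ with $f\le_{PR}\mathbf d$ and $f^{ -1}\le_{PR}\mathbf d$. $\mathrm{Cone}(\Delta^0_1)$ is the set of PR-degrees $\mathbf d$ such that $f\le_{PR}\mathbf d$ for every total computable function $f:\omega\to\omega$. -}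

module Defs where

open import Level using (0ℓ)
open import Data.Nat using (ℕ; zero; suc; _<_)
open import Data.Fin using (Fin)
open import Data.Vec using (Vec; []; _∷_; lookup)
open import Data.Empty using (⊥)
open import Data.Product using (Σ; ∃; _×_; _,_)
open import Relation.Binary.PropositionalEquality using (_≡_)
open import Algebra.Lattice.Structures {A = ℕ} _≡_ using (IsBooleanAlgebra)

-- Oracle signatures: O n = oracle symbols of arity n,
-- interpreted by an Interp.

Sig : Set₁
Sig = ℕ → Set

Interp : Sig → Set
Interp O = ∀ {n} → O n → Vec ℕ n → ℕ

NoOrc : Sig
NoOrc _ = ⊥

noOrc : Interp NoOrc
noOrc ()

FunOrc : Sig
FunOrc n = n ≡ 1

funOrc : (ℕ → ℕ) → Interp FunOrc
funOrc g _≡_.refl (x ∷ []) = g x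

data PR (O : Sig) : ℕ → Set where
  zer  : ∀ {n} → PR O n
  succ : PR O 1
  proj : ∀ {n} → Fin n → PR O n
  comp : ∀ {m n} → PR O m → Vec (PR O n) m → PR O n
  prec : ∀ {n} → PR O n → PR O (suc (suc n)) → PR O (suc n)
  orc  : ∀ {n} → O n → PR O n

module _ {O : Sig} (σ : Interp O) where
  mutual
    evalPR : ∀ {n} → PR O n → Vec ℕ n → ℕ
    evalPR zer xs = 0
    evalPR succ (x ∷ []) = suc x
    evalPR (proj i) xs = lookup xs i
    evalPR (comp f gs) xs = evalPR f (evalPRs gs xs)
    evalPR (prec g h) (zero ∷ xs) = evalPR g xs
    evalPR (prec g h) (suc y ∷ xs) = evalPR h (evalPR (prec g h) (y ∷ xs) ∷ y ∷ xs)
    evalPR (orc o) xs = σ o xs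

    evalPRs : ∀ {m n} → Vec (PR O n) m → Vec ℕ n → Vec ℕ m
    evalPRs [] xs = []
    evalPRs (g ∷ gs) xs = evalPR g xs ∷ evalPRs gs xs

PrimRec₁ : (ℕ → ℕ) → Set
PrimRec₁ f = Σ (PR NoOrc 1) λ t → ∀ x → evalPR noOrc t (x ∷ []) ≡ f x

PrimRec₂ : (ℕ → ℕ → ℕ) → Set
PrimRec₂ f = Σ (PR NoOrc 2) λ t → ∀ x y → evalPR noOrc t (x ∷ y ∷ []) ≡ f x y

_≤PR_ : (ℕ → ℕ) → (ℕ → ℕ) → Set
f ≤PR g = Σ (PR FunOrc 1) λ t → ∀ x → evalPR (funOrc g) t (x ∷ []) ≡ f x

data MuR (O : Sig) : ℕ → Set where
  zer  : ∀ {n} → MuR O n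
  succ : MuR O 1
  proj : ∀ {n} → Fin n → MuR O n
  comp : ∀ {m n} → MuR O m → Vec (MuR O n) m → MuR O n
  prec : ∀ {n} → MuR O n → MuR O (suc (suc n)) → MuR O (suc n)
  mu   : ∀ {n} → MuR O (suc n) → MuR O n
  orc  : ∀ {n} → O n → MuR O n

module _ {O : Sig} (σ : Interp O) where
  mutual
    data _⇓_ : ∀ {n} → MuR O n × Vec ℕ n → ℕ → Set where
      ev-zer  : ∀ {n} {xs : Vec ℕ n} → (zer , xs) ⇓ 0
      ev-succ : ∀ {x} → (succ , x ∷ []) ⇓ suc x
      ev-proj : ∀ {n} {i : Fin n} {xs} → (proj i , xs) ⇓ lookup xs i
      ev-comp : ∀ {m n} {f : MuR O m} {gs : Vec (MuR O n) m} {xs ys y} →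
                (gs , xs) ⇓s ys → (f , ys) ⇓ y → (comp f gs , xs) ⇓ y
      ev-prec0 : ∀ {n} {g : MuR O n} {h xs y} →
                 (g , xs) ⇓ y → (prec g h , zero ∷ xs) ⇓ y
      ev-precS : ∀ {n} {g : MuR O n} {h xs k r y} →
                 (prec g h , k ∷ xs) ⇓ r → (h , r ∷ k ∷ xs) ⇓ y →
                 (prec g h , suc k ∷ xs) ⇓ y
      ev-mu   : ∀ {n} {f : MuR O (suc n)} {xs y} →
                (f , y ∷ xs) ⇓ 0 →
                (∀ z → z < y → ∃ λ k → (f , z ∷ xs) ⇓ suc k) →
                (mu f , xs) ⇓ y
      ev-orc  : ∀ {n} {o : O n} {xs} → (orc o , xs) ⇓ σ o xs

    data _⇓s_ : ∀ {m n} → Vec (MuR O n) m × Vec ℕ n → Vec ℕ m → Set where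
      evs-[] : ∀ {n} {xs : Vec ℕ n} → ([] , xs) ⇓s []
      evs-∷  : ∀ {m n} {g : MuR O n} {gs : Vec (MuR O n) m} {xs y ys} →
               (g , xs) ⇓ y → (gs , xs) ⇓s ys → (g ∷ gs , xs) ⇓s (y ∷ ys)

ComputableRel : {O : Sig} → Interp O → (ℕ → ℕ) → Set
ComputableRel σ f = Σ (MuR _ 1) λ t → ∀ x → _⇓_ σ (t , x ∷ []) (f x)

Computable : (ℕ → ℕ) → Set
Computable f = ComputableRel noOrc f

record Str : Set where
  field
    join : ℕ → ℕ → ℕ
    meet : ℕ → ℕ → ℕ
    compl : ℕ → ℕ
    top : ℕ
    bot : ℕ
open Str public

IsBA : Str → Set
IsBA A = IsBooleanAlgebra (join A) (meet A) (compl A) (top A) (bot A)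

Punctual : Str → Set
Punctual A = PrimRec₂ (join A) × PrimRec₂ (meet A) × PrimRec₁ (compl A)

record IsIso (A C : Str) (f g : ℕ → ℕ) : Set where
  field
    left  : ∀ x → g (f x) ≡ x
    right : ∀ y → f (g y) ≡ y
    pres-join  : ∀ x y → f (join A x y) ≡ join C (f x) (f y)
    pres-meet  : ∀ x y → f (meet A x y) ≡ meet C (f x) (f y)
    pres-compl : ∀ x → f (compl A x) ≡ compl C (f x)
    pres-top   : f (top A) ≡ top C
    pres-bot   : f (bot A) ≡ bot C

_≅_ : Str → Str → Set
A ≅ C = Σ (ℕ → ℕ) λ f → Σ (ℕ → ℕ) λ g → IsIso A C f g

-- Oracle for the atomic diagram of a structure: its operations
data BASym : Sig where
  s-join s-meet : BASym 2
  s-compl : BASym 1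
  s-top s-bot : BASym 0

diag : Str → Interp BASym
diag C s-join (x ∷ y ∷ []) = join C x y
diag C s-meet (x ∷ y ∷ []) = meet C x y
diag C s-compl (x ∷ []) = compl C x
diag C s-top [] = top C
diag C s-bot [] = bot C

RelCompCat : Str → Set
RelCompCat A = ∀ (C : Str) → C ≅ A →
  Σ (ℕ → ℕ) λ f → Σ (ℕ → ℕ) λ g → IsIso C A f g × ComputableRel (diag C) f

-- PrCat(A), as a predicate on representatives d of PR-degrees
InPrCat : Str → (ℕ → ℕ) → Set
InPrCat A d = ∀ (C : Str) → Punctual C → C ≅ A →
  Σ (ℕ → ℕ) λ f → Σ (ℕ → ℕ) λ g → IsIso A C f g × f ≤PR d × g ≤PR d

InCone : (ℕ → ℕ) → Set
InCone d = ∀ (f : ℕ → ℕ) → Computable f → f ≤PR d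

{-# OPTIONS --safe #-}
module Submission where

-- (⇐) An isomorphism computable from the diagram of a punctual copy is computable, and so is its inverse.
--
-- (⇒) First, B has finitely many atoms. Otherwise code B through a generic permutation of ℕ. Against a
-- program, take a fresh atom a for which infinitely many atoms b lie in the same elements among those
-- already decided, and let c be its code. If the program can be made to output an atom on input c, then
-- the use of that computation survives replacing each decoded x by x ∨ b if a ≤ x and by x ∧ ¬ b
-- otherwise, for a large such b; after this c codes the non-atom a ∨ b. So no isomorphism is
-- computable from the generic copy.
--
-- Now B is determined up to isomorphism by its number k of atoms. For a computable f there is a punctual
-- algebra with k atoms in which a certain element e n can be split only by numbers exceeding the running
-- time of f n, and another in which every atomless element is split by an element found primitive
-- recursively. Splitting the image of e n in the second and pulling the parts back bounds
-- the running time of f n, primitive recursively in an isomorphism and its inverse.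

-- Being an atom is a universal property, so no finite part of a diagram certifies it. The
-- replacement of x by x ∨ b or x ∧ ¬ b works because it is dual to the map of points that sends b
-- to a and fixes the rest: it is an endomorphism, so it carries over every recorded equation, and
-- its kernel is only {⊥, b}, so decided elements stay distinct once b is none of their differences.
--
-- A punctual copy has domain ω and cannot wait: while f n is still running it must go on listing
-- new elements without splitting e n. Hence elements are coded by maps on a tree. This makes a
-- split found early expensive in one copy and bounded in the other.
--
-- Two auxiliary copies are compared because nothing is known about how fast B itself splits; B only
-- mediates between them.
--
-- Excluded middle enters only in the forcing argument and in extracting the number of atoms.

open import Defs
open import Level using (0ℓ)
open import Data.Nat hiding (_⊓_; _⊔_)
open import Data.Nat.Properties
open import Data.Bool using (Bool; true; false; not; _∧_; _∨_; _xor_; if_then_else_) renaming (_≟_ to _≟ᵇ_)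
open import Data.Fin using (Fin; zero; suc)
open import Data.Vec using (Vec; []; _∷_; lookup; head; tail; tabulate)
open import Data.List using (List; []; _∷_; _++_; map; allFin; cartesianProductWith)
open import Data.List.Relation.Unary.Any using (here; there)
open import Data.List.Membership.Propositional using (_∈_)
open import Data.List.Membership.Propositional.Properties
  using (∈-++⁺ˡ; ∈-++⁺ʳ; ∈-map⁺; ∈-allFin; ∈-cartesianProductWith⁺)
open import Data.Empty using (⊥; ⊥-elim)
open import Data.Product using (Σ; ∃; _×_; _,_; proj₁; proj₂)
open import Data.Sum using (_⊎_; inj₁; inj₂)
open import Function using (_∘_; id; case_of_)
open import Relation.Nullary using (¬_; Dec; yes; no)
open import Relation.Binary.PropositionalEquality
open import Relation.Binary.Definitions using (tri<; tri≈; tri>)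
open import Algebra.Lattice.Structures {A = ℕ} _≡_ using (IsBooleanAlgebra)
open import Algebra.Lattice.Bundles using (BooleanAlgebra)
import Algebra.Lattice.Properties.BooleanAlgebra as BAProperties
open import Axiom.ExcludedMiddle using (ExcludedMiddle)
open import Function.Bundles using (_⇔_; mk⇔)

-- Quasi-identities of Boolean algebras

infixr 7 _⊓_
infixr 6 _⊔_
infix 4 _≈_

data Term (n : ℕ) : Set where
  var     : Fin n → Term n
  _⊓_ _⊔_ : Term n → Term n → Term n
  ∁       : Term n → Term n
  𝟙 𝟘     : Term n

Equation : ℕ → Set
Equation n = Term n × Term n

_≈_ : ∀ {n} → Term n → Term n → Equation n
_≈_ = _,_

truth : ∀ {n} → Term n → Vec Bool n → Bool
truth (var i) β = lookup β i
truth (s ⊓ t) β = truth s β ∧ truth t β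
truth (s ⊔ t) β = truth s β ∨ truth t β
truth (∁ t) β = not (truth t β)
truth 𝟙 β = true
truth 𝟘 β = false

_==ᵇ_ : Bool → Bool → Bool
true ==ᵇ b = b
false ==ᵇ b = not b

==ᵇ-sound : ∀ a b → (a ==ᵇ b) ≡ true → a ≡ b
==ᵇ-sound true true e = refl
==ᵇ-sound false false e = refl

-- Boolean-valued, so that the validity of a concrete quasi-identity is a closed computation and
-- `refl` proves it at each use of `quasi`.
entails : ∀ {n} → List (Equation n) → Equation n → Vec Bool n → Bool
entails [] (s , t) β = truth s β ==ᵇ truth t β
entails ((u , v) ∷ hs) g β = not (truth u β ==ᵇ truth v β) ∨ entails hs g β

everywhere : ∀ n → (Vec Bool n → Bool) → Bool
everywhere zero P = P []
everywhere (suc n) P = everywhere n (λ β → P (true ∷ β) ∧ P (false ∷ β))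

∧-true : ∀ a b → a ∧ b ≡ true → a ≡ true × b ≡ true
∧-true true true e = refl , refl

everywhere-sound : ∀ n P → everywhere n P ≡ true → ∀ β → P β ≡ true
everywhere-sound zero P e [] = e
everywhere-sound (suc n) P e (b ∷ β) with ∧-true (P (true ∷ β)) _ (everywhere-sound n _ e β)
everywhere-sound (suc n) P e (true ∷ β) | p , _ = p
everywhere-sound (suc n) P e (false ∷ β) | _ , q = q

module Algebra (A : Str) (isBA : IsBA A) where

  infixr 7 _⋏_
  infixr 6 _⋎_
  _⋏_ _⋎_ : ℕ → ℕ → ℕ
  _⋏_ = meet A
  _⋎_ = join A
  ∼ : ℕ → ℕ
  ∼ = compl A
  ⊤A ⊥A : ℕ
  ⊤A = top A
  ⊥A = bot A

  bundle : BooleanAlgebra 0ℓ 0ℓ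
  bundle = record { isBooleanAlgebra = isBA }

  open IsBooleanAlgebra isBA
    using (∧-comm; ∧-assoc; ∧-complementˡ; ∧-complementʳ; ∨-complementʳ; ∧-distribˡ-∨; ∧-distribʳ-∨)
  open BAProperties bundle
    using (∧-identityʳ; ∧-identityˡ; ∧-zeroʳ; ∧-zeroˡ; ∨-identityˡ; ∨-zeroˡ
          ; ¬⊥≈⊤; ¬⊤≈⊥; deMorgan₁; ∧-idem)

  ⟦_⟧ : ∀ {n} → Term n → Vec ℕ n → ℕ
  ⟦ var i ⟧ ρ = lookup ρ i
  ⟦ s ⊓ t ⟧ ρ = ⟦ s ⟧ ρ ⋏ ⟦ t ⟧ ρ
  ⟦ s ⊔ t ⟧ ρ = ⟦ s ⟧ ρ ⋎ ⟦ t ⟧ ρ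
  ⟦ ∁ t ⟧ ρ = ∼ (⟦ t ⟧ ρ)
  ⟦ 𝟙 ⟧ ρ = ⊤A
  ⟦ 𝟘 ⟧ ρ = ⊥A

  const : Bool → ℕ
  const true = ⊤A
  const false = ⊥A

  minterm : ∀ {n} → Vec Bool n → Vec ℕ n → ℕ
  minterm [] [] = ⊤A
  minterm (true ∷ β) (x ∷ ρ) = x ⋏ minterm β ρ
  minterm (false ∷ β) (x ∷ ρ) = ∼ x ⋏ minterm β ρ

  const-∧ : ∀ a b → const a ⋏ const b ≡ const (a ∧ b)
  const-∧ true b = ∧-identityˡ _
  const-∧ false b = ∧-zeroˡ _

  const-∨ : ∀ a b → const a ⋎ const b ≡ const (a ∨ b)
  const-∨ true b = ∨-zeroˡ _
  const-∨ false b = ∨-identityˡ _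

  const-not : ∀ a → ∼ (const a) ≡ const (not a)
  const-not true = ¬⊤≈⊥
  const-not false = ¬⊥≈⊤

  -- Having the same meet with `m` is the kernel of restriction to the interval below `m`. This and
  -- the lemmas down to `below-∼` make it a congruence, so that a term can be evaluated one minterm
  -- at a time.
  below-⋏ : ∀ m {a b a′ b′} → m ⋏ a ≡ m ⋏ a′ → m ⋏ b ≡ m ⋏ b′ → m ⋏ (a ⋏ b) ≡ m ⋏ (a′ ⋏ b′)
  below-⋏ m {a} {b} {a′} {b′} p q = begin
    m ⋏ (a ⋏ b)    ≡⟨ ∧-assoc m a b ⟨
    (m ⋏ a) ⋏ b    ≡⟨ cong (_⋏ b) p ⟩
    (m ⋏ a′) ⋏ b   ≡⟨ cong (_⋏ b) (∧-comm m a′) ⟩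
    (a′ ⋏ m) ⋏ b   ≡⟨ ∧-assoc a′ m b ⟩
    a′ ⋏ (m ⋏ b)   ≡⟨ cong (a′ ⋏_) q ⟩
    a′ ⋏ (m ⋏ b′)  ≡⟨ ∧-assoc a′ m b′ ⟨
    (a′ ⋏ m) ⋏ b′  ≡⟨ cong (_⋏ b′) (∧-comm a′ m) ⟩
    (m ⋏ a′) ⋏ b′  ≡⟨ ∧-assoc m a′ b′ ⟩
    m ⋏ (a′ ⋏ b′)  ∎
    where open ≡-Reasoning

  below-⋎ : ∀ m {a b a′ b′} → m ⋏ a ≡ m ⋏ a′ → m ⋏ b ≡ m ⋏ b′ → m ⋏ (a ⋎ b) ≡ m ⋏ (a′ ⋎ b′)
  below-⋎ m p q = trans (∧-distribˡ-∨ m _ _) (trans (cong₂ _⋎_ p q) (sym (∧-distribˡ-∨ m _ _)))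

  below-∼-⋏ : ∀ m a → m ⋏ ∼ a ≡ m ⋏ ∼ (m ⋏ a)
  below-∼-⋏ m a = begin
    m ⋏ ∼ a              ≡⟨ ∨-identityˡ _ ⟨
    ⊥A ⋎ m ⋏ ∼ a         ≡⟨ cong (_⋎ m ⋏ ∼ a) (∧-complementʳ m) ⟨
    m ⋏ ∼ m ⋎ m ⋏ ∼ a    ≡⟨ ∧-distribˡ-∨ m _ _ ⟨
    m ⋏ (∼ m ⋎ ∼ a)      ≡⟨ cong (m ⋏_) (deMorgan₁ m a) ⟨
    m ⋏ ∼ (m ⋏ a)        ∎
    where open ≡-Reasoning

  below-∼ : ∀ m {a a′} → m ⋏ a ≡ m ⋏ a′ → m ⋏ ∼ a ≡ m ⋏ ∼ a′
  below-∼ m {a} {a′} p =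
    trans (below-∼-⋏ m a) (trans (cong (λ z → m ⋏ ∼ z) p) (sym (below-∼-⋏ m a′)))

  minterm-var : ∀ {n} (β : Vec Bool n) ρ i →
                minterm β ρ ⋏ lookup ρ i ≡ minterm β ρ ⋏ const (lookup β i)
  minterm-var (true ∷ β) (x ∷ ρ) zero = begin
    (x ⋏ minterm β ρ) ⋏ x  ≡⟨ cong (_⋏ x) (∧-comm x _) ⟩
    (minterm β ρ ⋏ x) ⋏ x  ≡⟨ ∧-assoc _ x x ⟩
    minterm β ρ ⋏ (x ⋏ x)  ≡⟨ cong (minterm β ρ ⋏_) (∧-idem x) ⟩
    minterm β ρ ⋏ x        ≡⟨ ∧-comm _ x ⟩
    x ⋏ minterm β ρ        ≡⟨ ∧-identityʳ _ ⟨
    (x ⋏ minterm β ρ) ⋏ ⊤A ∎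
    where open ≡-Reasoning
  minterm-var (false ∷ β) (x ∷ ρ) zero = begin
    (∼ x ⋏ minterm β ρ) ⋏ x  ≡⟨ cong (_⋏ x) (∧-comm (∼ x) _) ⟩
    (minterm β ρ ⋏ ∼ x) ⋏ x  ≡⟨ ∧-assoc _ (∼ x) x ⟩
    minterm β ρ ⋏ (∼ x ⋏ x)  ≡⟨ cong (minterm β ρ ⋏_) (∧-complementˡ x) ⟩
    minterm β ρ ⋏ ⊥A         ≡⟨ ∧-zeroʳ _ ⟩
    ⊥A                       ≡⟨ ∧-zeroʳ _ ⟨
    (∼ x ⋏ minterm β ρ) ⋏ ⊥A ∎
    where open ≡-Reasoning
  minterm-var (true ∷ β) (x ∷ ρ) (suc i) =
    trans (∧-assoc x _ _) (trans (cong (x ⋏_) (minterm-var β ρ i)) (sym (∧-assoc x _ _)))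
  minterm-var (false ∷ β) (x ∷ ρ) (suc i) =
    trans (∧-assoc (∼ x) _ _) (trans (cong (∼ x ⋏_) (minterm-var β ρ i)) (sym (∧-assoc (∼ x) _ _)))

  minterm-term : ∀ {n} (β : Vec Bool n) ρ t → minterm β ρ ⋏ ⟦ t ⟧ ρ ≡ minterm β ρ ⋏ const (truth t β)
  minterm-term β ρ (var i) = minterm-var β ρ i
  minterm-term β ρ (s ⊓ t) =
    trans (below-⋏ _ (minterm-term β ρ s) (minterm-term β ρ t)) (cong (_ ⋏_) (const-∧ (truth s β) _))
  minterm-term β ρ (s ⊔ t) =
    trans (below-⋎ _ (minterm-term β ρ s) (minterm-term β ρ t)) (cong (_ ⋏_) (const-∨ (truth s β) _))
  minterm-term β ρ (∁ t) =
    trans (below-∼ _ (minterm-term β ρ t)) (cong (_ ⋏_) (const-not (truth t β)))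
  minterm-term β ρ 𝟙 = refl
  minterm-term β ρ 𝟘 = refl

  by-cases : ∀ x {u v} → x ⋏ u ≡ x ⋏ v → ∼ x ⋏ u ≡ ∼ x ⋏ v → u ≡ v
  by-cases x {u} {v} p q = begin
    u                  ≡⟨ expand u ⟩
    x ⋏ u ⋎ ∼ x ⋏ u    ≡⟨ cong₂ _⋎_ p q ⟩
    x ⋏ v ⋎ ∼ x ⋏ v    ≡⟨ expand v ⟨
    v                  ∎
    where
    open ≡-Reasoning
    expand : ∀ w → w ≡ x ⋏ w ⋎ ∼ x ⋏ w
    expand w = begin
      w                ≡⟨ ∧-identityˡ w ⟨
      ⊤A ⋏ w           ≡⟨ cong (_⋏ w) (∨-complementʳ x) ⟨
      (x ⋎ ∼ x) ⋏ w    ≡⟨ ∧-distribʳ-∨ w x (∼ x) ⟩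
      x ⋏ w ⋎ ∼ x ⋏ w  ∎

  -- The minterms cover the top element: each entry of `ρ` cuts the algebra in two, and `by-cases`
  -- puts the halves together again.
  by-minterms : ∀ {n} (ρ : Vec ℕ n) {u v} → (∀ β → minterm β ρ ⋏ u ≡ minterm β ρ ⋏ v) → u ≡ v
  by-minterms [] h = trans (sym (∧-identityˡ _)) (trans (h []) (∧-identityˡ _))
  by-minterms (x ∷ ρ) {u} {v} h =
    by-cases x (by-minterms ρ λ β → shift β (h (true ∷ β))) (by-minterms ρ λ β → shift β (h (false ∷ β)))
    where
    swap : ∀ y β w → (y ⋏ minterm β ρ) ⋏ w ≡ minterm β ρ ⋏ (y ⋏ w)
    swap y β w = trans (cong (_⋏ w) (∧-comm y _)) (∧-assoc _ y w)
    shift : ∀ {y} β → (y ⋏ minterm β ρ) ⋏ u ≡ (y ⋏ minterm β ρ) ⋏ v →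
            minterm β ρ ⋏ (y ⋏ u) ≡ minterm β ρ ⋏ (y ⋏ v)
    shift {y} β e = trans (sym (swap y β u)) (trans e (swap y β v))

  Holds : ∀ {n} → Vec ℕ n → Equation n → Set
  Holds ρ (s , t) = ⟦ s ⟧ ρ ≡ ⟦ t ⟧ ρ

  Implication : ∀ {n} → Vec ℕ n → List (Equation n) → Equation n → Set
  Implication ρ [] g = Holds ρ g
  Implication ρ (h ∷ hs) g = Holds ρ h → Implication ρ hs g

  vacuous : ∀ {m} → m ⋏ ⊤A ≡ m ⋏ ⊥A → ∀ u v → m ⋏ u ≡ m ⋏ v
  vacuous {m} e u v = trans (zero-meet u) (sym (zero-meet v))
    where
    zero-meet : ∀ w → m ⋏ w ≡ ⊥A
    zero-meet w = trans (cong (_⋏ w) (trans (sym (∧-identityʳ m)) (trans e (∧-zeroʳ m)))) (∧-zeroˡ w)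

  -- A quasi-identity valid in the two-element algebra holds in every Boolean algebra.
  quasi : ∀ {n} (ρ : Vec ℕ n) hs g → everywhere n (entails hs g) ≡ true → Implication ρ hs g
  quasi {n} ρ hs g e = discharge hs λ β → inj₁ (everywhere-sound n _ e β)
    where
    Local : Vec Bool n → Set
    Local β = minterm β ρ ⋏ ⟦ proj₁ g ⟧ ρ ≡ minterm β ρ ⋏ ⟦ proj₂ g ⟧ ρ

    local : ∀ β s t → minterm β ρ ⋏ const (truth s β) ≡ minterm β ρ ⋏ const (truth t β) →
            minterm β ρ ⋏ ⟦ s ⟧ ρ ≡ minterm β ρ ⋏ ⟦ t ⟧ ρ
    local β s t eq = trans (minterm-term β ρ s) (trans eq (sym (minterm-term β ρ t)))

    refute : ∀ m a b → (a ==ᵇ b) ≡ false → m ⋏ const a ≡ m ⋏ const b → ∀ u v → m ⋏ u ≡ m ⋏ v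
    refute m true false _ eq = vacuous eq
    refute m false true _ eq = vacuous (sym eq)

    discharge : ∀ hs → (∀ β → entails hs g β ≡ true ⊎ Local β) → Implication ρ hs g
    discharge [] h = by-minterms ρ λ β → settle β (h β)
      where
      settle : ∀ β → entails [] g β ≡ true ⊎ Local β → Local β
      settle β (inj₂ l) = l
      settle β (inj₁ p) = local β (proj₁ g) (proj₂ g)
        (cong (λ b → minterm β ρ ⋏ const b) (==ᵇ-sound (truth (proj₁ g) β) _ p))
    discharge ((u , v) ∷ hs) h eq = discharge hs λ β → step β (h β)
      where
      step : ∀ β → entails ((u , v) ∷ hs) g β ≡ true ⊎ Local β → entails hs g β ≡ true ⊎ Local β
      step β (inj₂ l) = inj₂ l
      step β (inj₁ p) with truth u β ==ᵇ truth v β in q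
      ... | true = inj₁ p
      -- A hypothesis that fails at `β` equates ⊤ with ⊥ below the minterm of `β`; that minterm is
      -- then ⊥, and below it any conclusion holds.
      ... | false = inj₂ (refute _ (truth u β) (truth v β) q
        (trans (sym (minterm-term β ρ u)) (trans (cong (minterm β ρ ⋏_) eq) (minterm-term β ρ v))) _ _)

-- Back and forth

v₀ : ∀ {n} → Term (1 + n)
v₀ = var zero
v₁ : ∀ {n} → Term (2 + n)
v₁ = var (suc zero)
v₂ : ∀ {n} → Term (3 + n)
v₂ = var (suc (suc zero))
v₃ : ∀ {n} → Term (4 + n)
v₃ = var (suc (suc (suc zero)))

Below : Str → ℕ → ℕ → Set
Below A x y = meet A x y ≡ x

Atom : Str → ℕ → Set
Atom A a = a ≢ bot A × (∀ x → Below A x a → x ≡ bot A ⊎ x ≡ a)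

Between : Str → ℕ → ℕ → Set
Between A z x = Below A z x × z ≢ bot A × z ≢ x

-- The positive form hands over a split instead of denying atoms, which keeps the back-and-forth
-- construction free of excluded middle.
Atomless : Str → ℕ → Set
Atomless A w = ∀ x → Below A x w → x ≢ bot A → ∃ λ z → Between A z x

-- The number of atoms below `w`, provided that what they leave is nonzero and atomless. Only the
-- meet with `a` has to be an atom, so that a derivation has the same shape as the right spine of a
-- `Match`.
data AtomicRank (A : Str) (w : ℕ) : ℕ → Set where
  atomless : w ≢ bot A → Atomless A w → AtomicRank A w 0
  splitAtom : ∀ {n} a → Atom A (meet A w a) → AtomicRank A (meet A w (compl A a)) n →
              AtomicRank A w (suc n)

-- The three kinds of corresponding pieces for which every splitting of one side can be imitated on
-- the other, with parts of corresponding kinds again.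
data Alike (A C : Str) (w w′ : ℕ) : Set where
  zeros     : w ≡ bot A → w′ ≡ bot C → Alike A C w w′
  atoms     : Atom A w → Atom C w′ → Alike A C w w′
  atomlesss : w ≢ bot A → Atomless A w → w′ ≢ bot C → Atomless C w′ → Alike A C w w′

Atomless-below : ∀ A → IsBA A → ∀ {w v} → Below A v w → Atomless A w → Atomless A v
Atomless-below A isA {w} {v} v≤w h x x≤v =
  h x (quasi (x ∷ v ∷ w ∷ []) ((v₀ ⊓ v₁ ≈ v₀) ∷ (v₁ ⊓ v₂ ≈ v₁) ∷ []) (v₀ ⊓ v₂ ≈ v₀) refl x≤v v≤w)
  where open Algebra A isA

-- A finite partial isomorphism: a binary tree of simultaneous splittings of w and w′.
data Match (A C : Str) (w w′ : ℕ) : Set where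
  leaf : Alike A C w w′ → Match A C w w′
  node : ∀ z z′ → Match A C (meet A w z) (meet C w′ z′) →
         Match A C (meet A w (compl A z)) (meet C w′ (compl C z′)) → Match A C w w′

-- Each leaf lies inside both `x` and `y` or outside both, so `x` and `y` are built from
-- corresponding leaves. Nothing is said about the parts of `x` and `y` outside `w` and `w′`.
Pairs : ∀ {A C w w′} → Match A C w w′ → ℕ → ℕ → Set
Pairs {A} {C} {w} {w′} (leaf _) x y =
  (Below A w x × Below C w′ y) ⊎ (Below A w (compl A x) × Below C w′ (compl C y))
Pairs (node z z′ l r) x y = Pairs l x y × Pairs r x y

Alike-flip : ∀ {A C w w′} → Alike A C w w′ → Alike C A w′ w
Alike-flip (zeros p q) = zeros q p
Alike-flip (atoms p q) = atoms q p
Alike-flip (atomlesss p q r s) = atomlesss r s p q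

flip : ∀ {A C w w′} → Match A C w w′ → Match C A w′ w
flip (leaf s) = leaf (Alike-flip s)
flip (node z z′ l r) = node z′ z (flip l) (flip r)

flip-Pairs : ∀ {A C w w′} (T : Match A C w w′) {x y} → Pairs T x y → Pairs (flip T) y x
flip-Pairs (leaf s) (inj₁ (p , q)) = inj₁ (q , p)
flip-Pairs (leaf s) (inj₂ (p , q)) = inj₂ (q , p)
flip-Pairs (node z z′ l r) (p , q) = flip-Pairs l p , flip-Pairs r q

module Extension (A C : Str) (isA : IsBA A) (isC : IsBA C) where
  module A = Algebra A isA
  module C = Algebra C isC

  -- If `x` does not really cut `w`, then ⊥ or ⊤ answers it. If it does, `w` is neither zero nor an
  -- atom, so both sides are atomless and any proper part of `w′` will do.
  splitAlike : ∀ {w w′} → Alike A C w w′ → ∀ x → ∃ λ y →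
               Alike A C (meet A w x) (meet C w′ y) × Alike A C (meet A w (compl A x)) (meet C w′ (compl C y))
  splitAlike {w} {w′} s x with meet A w x ≟ bot A | meet A w (compl A x) ≟ bot A
  ... | yes p | _ = bot C ,
        zeros p (C.quasi (w′ ∷ []) [] (v₀ ⊓ 𝟘 ≈ 𝟘) refl) ,
        subst₂ (Alike A C)
          (A.quasi (w ∷ x ∷ []) ((v₀ ⊓ v₁ ≈ 𝟘) ∷ []) (v₀ ≈ v₀ ⊓ ∁ v₁) refl p)
          (C.quasi (w′ ∷ []) [] (v₀ ≈ v₀ ⊓ ∁ 𝟘) refl) s
  ... | no _ | yes p = top C ,
        subst₂ (Alike A C)
          (A.quasi (w ∷ x ∷ []) ((v₀ ⊓ ∁ v₁ ≈ 𝟘) ∷ []) (v₀ ≈ v₀ ⊓ v₁) refl p)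
          (C.quasi (w′ ∷ []) [] (v₀ ≈ v₀ ⊓ 𝟙) refl) s ,
        zeros p (C.quasi (w′ ∷ []) [] (v₀ ⊓ ∁ 𝟙 ≈ 𝟘) refl)
  splitAlike {w} {w′} (zeros w≡⊥ _) x | no p | no _ =
    ⊥-elim (p (A.quasi (w ∷ x ∷ []) ((v₀ ≈ 𝟘) ∷ []) (v₀ ⊓ v₁ ≈ 𝟘) refl w≡⊥))
  splitAlike {w} {w′} (atoms (_ , at) _) x | no p | no q
    with at (meet A w x) (A.quasi (w ∷ x ∷ []) [] ((v₀ ⊓ v₁) ⊓ v₀ ≈ v₀ ⊓ v₁) refl)
  ... | inj₁ e = ⊥-elim (p e)
  ... | inj₂ e = ⊥-elim (q (A.quasi (w ∷ x ∷ []) ((v₀ ⊓ v₁ ≈ v₀) ∷ []) (v₀ ⊓ ∁ v₁ ≈ 𝟘) refl e))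
  splitAlike {w} {w′} (atomlesss w≢⊥ al w′≢⊥ al′) x | no p | no q
    with al′ w′ (C.quasi (w′ ∷ []) [] (v₀ ⊓ v₀ ≈ v₀) refl) w′≢⊥
  ... | z , z≤w′ , z≢⊥ , z≢w′ = z ,
        atomlesss p (Atomless-below A isA (A.quasi (w ∷ x ∷ []) [] ((v₀ ⊓ v₁) ⊓ v₀ ≈ v₀ ⊓ v₁) refl) al)
          (λ e → z≢⊥ (C.quasi (w′ ∷ z ∷ []) ((v₁ ⊓ v₀ ≈ v₁) ∷ (v₀ ⊓ v₁ ≈ 𝟘) ∷ []) (v₁ ≈ 𝟘) refl z≤w′ e))
          (Atomless-below C isC (C.quasi (w′ ∷ z ∷ []) [] ((v₀ ⊓ v₁) ⊓ v₀ ≈ v₀ ⊓ v₁) refl) al′) ,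
        atomlesss q (Atomless-below A isA (A.quasi (w ∷ x ∷ []) [] ((v₀ ⊓ ∁ v₁) ⊓ v₀ ≈ v₀ ⊓ ∁ v₁) refl) al)
          (λ e → z≢w′ (C.quasi (w′ ∷ z ∷ []) ((v₁ ⊓ v₀ ≈ v₁) ∷ (v₀ ⊓ ∁ v₁ ≈ 𝟘) ∷ []) (v₁ ≈ v₀) refl z≤w′ e))
          (Atomless-below C isC (C.quasi (w′ ∷ z ∷ []) [] ((v₀ ⊓ ∁ v₁) ⊓ v₀ ≈ v₀ ⊓ ∁ v₁) refl) al′)

  -- A tree over `w′` sees only the part of `y` below `w′`; this is what permits answers from
  -- different subtrees to be combined.
  Pairs-local : ∀ {w w′} (T : Match A C w w′) {x y y₁} → meet C w′ y ≡ meet C w′ y₁ → Pairs T x y → Pairs T x y₁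
  Pairs-local {w} {w′} (leaf _) {x} {y} {y₁} e (inj₁ (p , q)) = inj₁ (p ,
    C.quasi (w′ ∷ y ∷ y₁ ∷ []) ((v₀ ⊓ v₁ ≈ v₀ ⊓ v₂) ∷ (v₀ ⊓ v₁ ≈ v₀) ∷ []) (v₀ ⊓ v₂ ≈ v₀) refl e q)
  Pairs-local {w} {w′} (leaf _) {x} {y} {y₁} e (inj₂ (p , q)) = inj₂ (p ,
    C.quasi (w′ ∷ y ∷ y₁ ∷ []) ((v₀ ⊓ v₁ ≈ v₀ ⊓ v₂) ∷ (v₀ ⊓ ∁ v₁ ≈ v₀) ∷ []) (v₀ ⊓ ∁ v₂ ≈ v₀) refl e q)
  Pairs-local {w} {w′} (node z z′ l r) {x} {y} {y₁} e (p , q) =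
    Pairs-local l (C.quasi (w′ ∷ y ∷ y₁ ∷ z′ ∷ []) ((v₀ ⊓ v₁ ≈ v₀ ⊓ v₂) ∷ []) ((v₀ ⊓ v₃) ⊓ v₁ ≈ (v₀ ⊓ v₃) ⊓ v₂) refl e) p ,
    Pairs-local r (C.quasi (w′ ∷ y ∷ y₁ ∷ z′ ∷ []) ((v₀ ⊓ v₁ ≈ v₀ ⊓ v₂) ∷ []) ((v₀ ⊓ ∁ v₃) ⊓ v₁ ≈ (v₀ ⊓ ∁ v₃) ⊓ v₂) refl e) q

  _⊑_ : ∀ {w w′} → Match A C w w′ → Match A C w w′ → Set
  T ⊑ U = ∀ x y → Pairs T x y → Pairs U x y

  extend : ∀ {w w′} (T : Match A C w w′) x → ∃ λ U → T ⊑ U × ∃ λ y → Pairs U x y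
  extend {w} {w′} (leaf s) x with splitAlike s x
  ... | y , l , r = node x y (leaf l) (leaf r) , grows , y ,
        inj₁ (A.quasi (w ∷ x ∷ []) [] ((v₀ ⊓ v₁) ⊓ v₁ ≈ v₀ ⊓ v₁) refl ,
              C.quasi (w′ ∷ y ∷ []) [] ((v₀ ⊓ v₁) ⊓ v₁ ≈ v₀ ⊓ v₁) refl) ,
        inj₂ (A.quasi (w ∷ x ∷ []) [] ((v₀ ⊓ ∁ v₁) ⊓ ∁ v₁ ≈ v₀ ⊓ ∁ v₁) refl ,
              C.quasi (w′ ∷ y ∷ []) [] ((v₀ ⊓ ∁ v₁) ⊓ ∁ v₁ ≈ v₀ ⊓ ∁ v₁) refl)
    where
    shrink : ∀ (D : Str) (isD : IsBA D) w z {x} → Below D w x → Below D (meet D w z) x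
    shrink D isD w z {x} e = Algebra.quasi D isD (w ∷ z ∷ x ∷ []) ((v₀ ⊓ v₂ ≈ v₀) ∷ []) ((v₀ ⊓ v₁) ⊓ v₂ ≈ v₀ ⊓ v₁) refl e
    grows : leaf s ⊑ node x y (leaf l) (leaf r)
    grows x₁ y₁ (inj₁ (p , q)) = inj₁ (shrink A isA w _ p , shrink C isC w′ _ q) , inj₁ (shrink A isA w _ p , shrink C isC w′ _ q)
    grows x₁ y₁ (inj₂ (p , q)) = inj₂ (shrink A isA w _ p , shrink C isC w′ _ q) , inj₂ (shrink A isA w _ p , shrink C isC w′ _ q)
  extend {w} {w′} (node z z′ l r) x with extend l x | extend r x
  ... | l⁺ , l⊑ , y₁ , p | r⁺ , r⊑ , y₂ , q =
        node z z′ l⁺ r⁺ , (λ x₁ y₁ (a , b) → l⊑ x₁ y₁ a , r⊑ x₁ y₁ b) , y ,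
        Pairs-local l⁺ (C.quasi (w′ ∷ z′ ∷ y₁ ∷ y₂ ∷ []) [] ((v₀ ⊓ v₁) ⊓ v₂ ≈ (v₀ ⊓ v₁) ⊓ (v₁ ⊓ v₂ ⊔ ∁ v₁ ⊓ v₃)) refl) p ,
        Pairs-local r⁺ (C.quasi (w′ ∷ z′ ∷ y₁ ∷ y₂ ∷ []) [] ((v₀ ⊓ ∁ v₁) ⊓ v₃ ≈ (v₀ ⊓ ∁ v₁) ⊓ (v₁ ⊓ v₂ ⊔ ∁ v₁ ⊓ v₃)) refl) q
    where
    -- The answers of the two subtrees are glued along `z′`: equal to `y₁` inside and to `y₂`
    -- outside.
    y : ℕ
    y = join C (meet C z′ y₁) (meet C (compl C z′) y₂)

  -- Two answers can disagree about a leaf only if the leaf is both inside and outside `x`. Then its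
  -- left half is zero, and by `Alike` so is its right half.
  Pairs-functional : ∀ {w w′} (T : Match A C w w′) {x y y₁} → Pairs T x y → Pairs T x y₁ → meet C w′ y ≡ meet C w′ y₁
  Pairs-functional {w} {w′} (leaf s) {x} {y} {y₁} = settle
    where
    collapse : Alike A C w w′ → Below A w x → Below A w (compl A x) → w′ ≡ bot C
    collapse s p q with A.quasi (w ∷ x ∷ []) ((v₀ ⊓ v₁ ≈ v₀) ∷ (v₀ ⊓ ∁ v₁ ≈ v₀) ∷ []) (v₀ ≈ 𝟘) refl p q
    collapse (zeros _ e) p q | _ = e
    collapse (atoms (n , _) _) p q | e = ⊥-elim (n e)
    collapse (atomlesss n _ _ _) p q | e = ⊥-elim (n e)
    bottom : w′ ≡ bot C → meet C w′ y ≡ meet C w′ y₁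
    bottom e = C.quasi (w′ ∷ y ∷ y₁ ∷ []) ((v₀ ≈ 𝟘) ∷ []) (v₀ ⊓ v₁ ≈ v₀ ⊓ v₂) refl e
    settle : Pairs (leaf s) x y → Pairs (leaf s) x y₁ → meet C w′ y ≡ meet C w′ y₁
    settle (inj₁ (p , q)) (inj₁ (_ , q₁)) = trans q (sym q₁)
    settle (inj₁ (p , q)) (inj₂ (p₁ , q₁)) = bottom (collapse s p p₁)
    settle (inj₂ (p , q)) (inj₁ (p₁ , q₁)) = bottom (collapse s p₁ p)
    settle (inj₂ (p , q)) (inj₂ (_ , q₁)) =
      C.quasi (w′ ∷ y ∷ y₁ ∷ []) ((v₀ ⊓ ∁ v₁ ≈ v₀) ∷ (v₀ ⊓ ∁ v₂ ≈ v₀) ∷ []) (v₀ ⊓ v₁ ≈ v₀ ⊓ v₂) refl q q₁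
  Pairs-functional {w} {w′} (node z z′ l r) {x} {y} {y₁} (p , q) (p₁ , q₁) =
    C.quasi (w′ ∷ z′ ∷ y ∷ y₁ ∷ []) (((v₀ ⊓ v₁) ⊓ v₂ ≈ (v₀ ⊓ v₁) ⊓ v₃) ∷ ((v₀ ⊓ ∁ v₁) ⊓ v₂ ≈ (v₀ ⊓ ∁ v₁) ⊓ v₃) ∷ [])
      (v₀ ⊓ v₂ ≈ v₀ ⊓ v₃) refl (Pairs-functional l p p₁) (Pairs-functional r q q₁)

  Pairs-meet : ∀ {w w′} (T : Match A C w w′) {x y x₁ y₁} → Pairs T x y → Pairs T x₁ y₁ → Pairs T (meet A x x₁) (meet C y y₁)
  Pairs-meet {w} {w′} (leaf _) {x} {y} {x₁} {y₁} = settle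
    where
    in₂ : ∀ (D : Str) (isD : IsBA D) w x x₁ → Below D w x → Below D w x₁ → Below D w (meet D x x₁)
    in₂ D isD w x x₁ = Algebra.quasi D isD (w ∷ x ∷ x₁ ∷ []) ((v₀ ⊓ v₁ ≈ v₀) ∷ (v₀ ⊓ v₂ ≈ v₀) ∷ []) (v₀ ⊓ (v₁ ⊓ v₂) ≈ v₀) refl
    outˡ : ∀ (D : Str) (isD : IsBA D) w x x₁ → Below D w (compl D x) → Below D w (compl D (meet D x x₁))
    outˡ D isD w x x₁ = Algebra.quasi D isD (w ∷ x ∷ x₁ ∷ []) ((v₀ ⊓ ∁ v₁ ≈ v₀) ∷ []) (v₀ ⊓ ∁ (v₁ ⊓ v₂) ≈ v₀) refl
    outʳ : ∀ (D : Str) (isD : IsBA D) w x x₁ → Below D w (compl D x₁) → Below D w (compl D (meet D x x₁))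
    outʳ D isD w x x₁ = Algebra.quasi D isD (w ∷ x ∷ x₁ ∷ []) ((v₀ ⊓ ∁ v₂ ≈ v₀) ∷ []) (v₀ ⊓ ∁ (v₁ ⊓ v₂) ≈ v₀) refl
    settle : _ → _ → _
    settle (inj₁ (p , q)) (inj₁ (p₁ , q₁)) = inj₁ (in₂ A isA w x x₁ p p₁ , in₂ C isC w′ y y₁ q q₁)
    settle (inj₂ (p , q)) _ = inj₂ (outˡ A isA w x x₁ p , outˡ C isC w′ y y₁ q)
    settle (inj₁ _) (inj₂ (p , q)) = inj₂ (outʳ A isA w x x₁ p , outʳ C isC w′ y y₁ q)
  Pairs-meet (node z z′ l r) (p , q) (p₁ , q₁) = Pairs-meet l p p₁ , Pairs-meet r q q₁

  Pairs-compl : ∀ {w w′} (T : Match A C w w′) {x y} → Pairs T x y → Pairs T (compl A x) (compl C y)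
  Pairs-compl {w} {w′} (leaf _) {x} {y} (inj₁ (p , q)) = inj₂
    (A.quasi (w ∷ x ∷ []) ((v₀ ⊓ v₁ ≈ v₀) ∷ []) (v₀ ⊓ ∁ (∁ v₁) ≈ v₀) refl p ,
     C.quasi (w′ ∷ y ∷ []) ((v₀ ⊓ v₁ ≈ v₀) ∷ []) (v₀ ⊓ ∁ (∁ v₁) ≈ v₀) refl q)
  Pairs-compl (leaf _) (inj₂ pq) = inj₁ pq
  Pairs-compl (node z z′ l r) (p , q) = Pairs-compl l p , Pairs-compl r q

  Pairs-top : ∀ {w w′} (T : Match A C w w′) → Pairs T (top A) (top C)
  Pairs-top {w} {w′} (leaf _) = inj₁ (A.quasi (w ∷ []) [] (v₀ ⊓ 𝟙 ≈ v₀) refl , C.quasi (w′ ∷ []) [] (v₀ ⊓ 𝟙 ≈ v₀) refl)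
  Pairs-top (node z z′ l r) = Pairs-top l , Pairs-top r

  Pairs-unique : (T : Match A C (top A) (top C)) → ∀ {x y y₁} → Pairs T x y → Pairs T x y₁ → y ≡ y₁
  Pairs-unique T {x} {y} {y₁} p q =
    C.quasi (y ∷ y₁ ∷ []) ((𝟙 ⊓ v₀ ≈ 𝟙 ⊓ v₁) ∷ []) (v₀ ≈ v₁) refl (Pairs-functional T p q)

  matchRanks : ∀ {w w′ n} → AtomicRank A w n → AtomicRank C w′ n → Match A C w w′
  matchRanks (atomless p al) (atomless p′ al′) = leaf (atomlesss p al p′ al′)
  matchRanks (splitAtom a at r) (splitAtom a′ at′ r′) = node a a′ (leaf (atoms at at′)) (matchRanks r r′)

module Homomorphism {A C : Str} (isA : IsBA A) (isC : IsBA C) (f : ℕ → ℕ)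
  (f-meet : ∀ x y → f (meet A x y) ≡ meet C (f x) (f y)) (f-compl : ∀ x → f (compl A x) ≡ compl C (f x))
  (f-top : f (top A) ≡ top C) where

  hom-join : ∀ x y → f (join A x y) ≡ join C (f x) (f y)
  hom-join x y = trans
    (cong f (Algebra.quasi A isA (x ∷ y ∷ []) [] (v₀ ⊔ v₁ ≈ ∁ (∁ v₀ ⊓ ∁ v₁)) refl))
    (trans (trans (f-compl _) (cong (compl C) (trans (f-meet _ _) (cong₂ (meet C) (f-compl x) (f-compl y)))))
      (Algebra.quasi C isC (f x ∷ f y ∷ []) [] (∁ (∁ v₀ ⊓ ∁ v₁) ≈ v₀ ⊔ v₁) refl))

  hom-bot : f (bot A) ≡ bot C
  hom-bot = trans (cong f (Algebra.quasi A isA [] [] (𝟘 ≈ ∁ 𝟙) refl))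
    (trans (f-compl _) (trans (cong (compl C) f-top) (Algebra.quasi C isC [] [] (∁ 𝟙 ≈ 𝟘) refl)))

module BackAndForth (A C : Str) (isA : IsBA A) (isC : IsBA C) (T₀ : Match A C (top A) (top C)) where
  module Forth = Extension A C isA isC
  module Back = Extension C A isC isA
  open Forth using (_⊑_)

  step : ∀ s (T : Match A C (top A) (top C)) →
         ∃ λ U → T ⊑ U × (∃ λ y → Pairs U s y) × (∃ λ x → Pairs U x s)
  step s T with Forth.extend T s
  ... | U , T⊑U , y , p with Back.extend (flip U) s
  ... | V , U⊑V , x , q = flip V , (λ x₁ y₁ r → keep (T⊑U x₁ y₁ r)) , (y , keep p) , (x , flip-Pairs V q)
    where
    keep : ∀ {x y} → Pairs U x y → Pairs (flip V) x y
    keep r = flip-Pairs V (U⊑V _ _ (flip-Pairs U r))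

  stage : ℕ → Match A C (top A) (top C)
  stage zero = T₀
  stage (suc s) = proj₁ (step s (stage s))

  grow : ∀ {s t} → s ≤′ t → stage s ⊑ stage t
  grow ≤′-refl x y p = p
  grow {t = suc t} (≤′-step s≤t) x y p = proj₁ (proj₂ (step t (stage t))) x y (grow s≤t x y p)

  to from : ℕ → ℕ
  to x = proj₁ (proj₁ (proj₂ (proj₂ (step x (stage x)))))
  from y = proj₁ (proj₂ (proj₂ (proj₂ (step y (stage y)))))

  late : ∀ {s t x y} → s ≤ t → Pairs (stage s) x y → Pairs (stage t) x y
  late s≤t = grow (≤⇒≤′ s≤t) _ _

  to-pairs : ∀ {x t} → x < t → Pairs (stage t) x (to x)
  to-pairs {x} x<t = late x<t (proj₂ (proj₁ (proj₂ (proj₂ (step x (stage x))))))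

  from-pairs : ∀ {y t} → y < t → Pairs (stage t) (from y) y
  from-pairs {y} y<t = late y<t (proj₂ (proj₂ (proj₂ (proj₂ (step y (stage y))))))

  uniqueʳ : ∀ t {x y y₁} → Pairs (stage t) x y → Pairs (stage t) x y₁ → y ≡ y₁
  uniqueʳ t = Forth.Pairs-unique (stage t)

  uniqueˡ : ∀ t {x x₁ y} → Pairs (stage t) x y → Pairs (stage t) x₁ y → x ≡ x₁
  uniqueˡ t p q = Back.Pairs-unique (flip (stage t)) (flip-Pairs (stage t) p) (flip-Pairs (stage t) q)

  iso : IsIso A C to from
  iso = record
    { left = λ x → let t = suc (x + to x) in
        uniqueˡ t (from-pairs (s≤s (m≤n+m (to x) x))) (to-pairs (s≤s (m≤m+n x (to x))))
    ; right = λ y → let t = suc (y + from y) in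
        uniqueʳ t (to-pairs (s≤s (m≤n+m (from y) y))) (from-pairs (s≤s (m≤m+n y (from y))))
    ; pres-join = hom-join
    ; pres-meet = to-meet
    ; pres-compl = to-compl
    ; pres-top = to-top
    ; pres-bot = hom-bot
    }
    where
    to-meet : ∀ x y → to (meet A x y) ≡ meet C (to x) (to y)
    to-meet x y = let t = suc (meet A x y + (x + y)) in
      uniqueʳ t (to-pairs (s≤s (m≤m+n _ _)))
        (Forth.Pairs-meet (stage t)
          (to-pairs (s≤s (≤-trans (m≤m+n x y) (m≤n+m _ (meet A x y)))))
          (to-pairs (s≤s (≤-trans (m≤n+m y x) (m≤n+m _ (meet A x y))))))
    to-compl : ∀ x → to (compl A x) ≡ compl C (to x)
    to-compl x = let t = suc (compl A x + x) in
      uniqueʳ t (to-pairs (s≤s (m≤m+n _ _)))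
        (Forth.Pairs-compl (stage t) (to-pairs (s≤s (m≤n+m x (compl A x)))))
    to-top : to (top A) ≡ top C
    to-top = let t = suc (top A) in uniqueʳ t (to-pairs (n<1+n _)) (Forth.Pairs-top (stage t))
    open Homomorphism isA isC to to-meet to-compl to-top

-- No effectiveness is claimed for this isomorphism: it only certifies that the auxiliary algebras
-- are copies of B, so that the hypothesis on `PrCat` applies to them.
sameRank⇒≅ : ∀ {A C n} → IsBA A → IsBA C → AtomicRank A (top A) n → AtomicRank C (top C) n → A ≅ C
sameRank⇒≅ {A} {C} isA isC r r′ = to , from , iso
  where open BackAndForth A C isA isC (Extension.matchRanks A C isA isC r r′)

-- Primitive recursion and evaluation with fuel

natrec : ℕ → (ℕ → ℕ → ℕ) → ℕ → ℕ
natrec z s zero = z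
natrec z s (suc k) = s k (natrec z s k)

bit01 : Bool → ℕ
bit01 false = 0
bit01 true = 1

pos : ℕ → Bool
pos zero = false
pos (suc _) = true

odd : ℕ → Bool
odd zero = false
odd (suc n) = not (odd n)

module PrimRec {O : Sig} (σ : Interp O) where

  Rec : ∀ {n} → (Vec ℕ n → ℕ) → Set
  Rec {n} f = Σ (PR O n) λ t → ∀ xs → evalPR σ t xs ≡ f xs

  RecV : ∀ {m n} → (Vec ℕ n → Vec ℕ m) → Set
  RecV {m} {n} f = Σ (Vec (PR O n) m) λ ts → ∀ xs → evalPRs σ ts xs ≡ f xs

  Recᵇ : ∀ {n} → (Vec ℕ n → Bool) → Set
  Recᵇ f = Rec (bit01 ∘ f)

  cast : ∀ {n} {f g : Vec ℕ n → ℕ} → (∀ xs → f xs ≡ g xs) → Rec f → Rec g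
  cast e (t , p) = t , λ xs → trans (p xs) (e xs)

  varR : ∀ {n} (i : Fin n) → Rec (λ xs → lookup xs i)
  varR i = proj i , λ xs → refl

  []R : ∀ {n} → RecV {n = n} (λ xs → [])
  []R = [] , λ xs → refl

  infixr 5 _∷R_
  _∷R_ : ∀ {m n} {f : Vec ℕ n → ℕ} {fs : Vec ℕ n → Vec ℕ m} → Rec f → RecV fs → RecV (λ xs → f xs ∷ fs xs)
  (t , p) ∷R (ts , ps) = t ∷ ts , λ xs → cong₂ _∷_ (p xs) (ps xs)

  app : ∀ {m n} {f : Vec ℕ m → ℕ} {gs : Vec ℕ n → Vec ℕ m} → Rec f → RecV gs → Rec (f ∘ gs)
  app {f = f} (t , p) (ts , ps) = comp t ts , λ xs → trans (p _) (cong f (ps xs))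

  pick : ∀ {m n} (ι : Fin m → Fin n) → RecV (λ xs → tabulate (λ i → lookup xs (ι i)))
  pick {zero} ι = []R
  pick {suc m} ι = varR (ι zero) ∷R pick (ι ∘ suc)

  dropR : ∀ {n} k → RecV {n} {k + n} (Data.Vec.drop k)
  dropR k = proj₁ (pick (raise k)) , λ xs → trans (proj₂ (pick (raise k)) xs) (dropped k xs)
    where
    open import Data.Fin using () renaming (_↑ʳ_ to raise)
    open import Data.Vec.Properties using (tabulate∘lookup)
    dropped : ∀ {n} k (xs : Vec ℕ (k + n)) → tabulate (λ i → lookup xs (raise k i)) ≡ Data.Vec.drop k xs
    dropped zero xs = tabulate∘lookup xs
    dropped (suc k) (x ∷ xs) = dropped k xs

  weaken : ∀ {n} k {f : Vec ℕ n → ℕ} → Rec f → Rec {k + n} (f ∘ Data.Vec.drop k)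
  weaken k r = app r (dropR k)

  zeroR : ∀ {n} → Rec {n} (λ xs → 0)
  zeroR = zer , λ xs → refl

  sucR : ∀ {n} {a : Vec ℕ n → ℕ} → Rec a → Rec (λ xs → suc (a xs))
  sucR (t , p) = comp succ (t ∷ []) , λ xs → cong suc (p xs)

  natrecR : ∀ {n} {z a : Vec ℕ n → ℕ} {g : Vec ℕ (2 + n) → ℕ} → Rec z → Rec g → Rec a →
            Rec (λ xs → natrec (z xs) (λ k r → g (r ∷ k ∷ xs)) (a xs))
  natrecR {n} {z} {a} {g} (tz , pz) (tg , pg) ra =
    proj₁ whole , λ xs → trans (proj₂ whole xs) (value (a xs) xs)
    where
    whole = app {f = evalPR σ (prec tz tg)} (prec tz tg , λ xs → refl) (ra ∷R dropR 0)
    value : ∀ k xs → evalPR σ (prec tz tg) (k ∷ xs) ≡ natrec (z xs) (λ k r → g (r ∷ k ∷ xs)) k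
    value zero xs = pz xs
    value (suc k) xs = trans (pg _) (cong (λ r → g (r ∷ k ∷ xs)) (value k xs))

  x₀ : ∀ {n} → Rec {1 + n} (λ xs → lookup xs zero)
  x₀ = varR zero
  x₁ : ∀ {n} → Rec {2 + n} (λ xs → lookup xs (suc zero))
  x₁ = varR (suc zero)
  x₂ : ∀ {n} → Rec {3 + n} (λ xs → lookup xs (suc (suc zero)))
  x₂ = varR (suc (suc zero))
  constR : ∀ {n} c → Rec {n} (λ xs → c)
  constR zero = zeroR
  constR (suc c) = sucR (constR c)

  predR : ∀ {n} {a : Vec ℕ n → ℕ} → Rec a → Rec (λ xs → pred (a xs))
  predR {a = a} ra = cast (λ xs → value (a xs)) (natrecR zeroR x₁ ra)
    where
    value : ∀ n → natrec 0 (λ k r → k) n ≡ pred n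
    value zero = refl
    value (suc n) = refl

  +R : ∀ {n} {a b : Vec ℕ n → ℕ} → Rec a → Rec b → Rec (λ xs → a xs + b xs)
  +R {a = a} {b} ra rb = cast (λ xs → value (a xs) (b xs)) (natrecR rb (sucR x₀) ra)
    where
    value : ∀ m n → natrec n (λ k r → suc r) m ≡ m + n
    value zero n = refl
    value (suc m) n = cong suc (value m n)

  ∸R : ∀ {n} {a b : Vec ℕ n → ℕ} → Rec a → Rec b → Rec (λ xs → a xs ∸ b xs)
  ∸R {a = a} {b} ra rb = cast (λ xs → value (a xs) (b xs)) (natrecR ra (predR x₀) rb)
    where
    value : ∀ m n → natrec m (λ k r → pred r) n ≡ m ∸ n
    value m zero = refl
    value m (suc n) = trans (cong pred (value m n)) (pred[m∸n]≡m∸[1+n] m n)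

  posR : ∀ {n} {a : Vec ℕ n → ℕ} → Rec a → Recᵇ (λ xs → pos (a xs))
  posR {a = a} ra = cast (λ xs → value (a xs)) (natrecR zeroR (constR 1) ra)
    where
    value : ∀ n → natrec 0 (λ k r → 1) n ≡ bit01 (pos n)
    value zero = refl
    value (suc n) = refl

  constᵇR : ∀ {n} b → Recᵇ {n} (λ xs → b)
  constᵇR b = constR (bit01 b)

  ifR : ∀ {n} {c : Vec ℕ n → Bool} {a b : Vec ℕ n → ℕ} → Recᵇ c → Rec a → Rec b →
        Rec (λ xs → if c xs then a xs else b xs)
  ifR {c = c} {a} {b} rc ra rb = cast (λ xs → value (c xs)) (natrecR rb (weaken 2 ra) rc)
    where
    value : ∀ c {x y} → natrec y (λ k r → x) (bit01 c) ≡ (if c then x else y)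
    value false = refl
    value true = refl

  boolR : ∀ {n} (β : Bool → Bool → Bool) {c d : Vec ℕ n → Bool} → Recᵇ c → Recᵇ d → Recᵇ (λ xs → β (c xs) (d xs))
  boolR β {c} {d} rc rd = cast (λ xs → value (c xs) (d xs))
    (ifR rc (ifR rd (constᵇR (β true true)) (constᵇR (β true false)))
            (ifR rd (constᵇR (β false true)) (constᵇR (β false false))))
    where
    value : ∀ c d → (if c then (if d then bit01 (β true true) else bit01 (β true false))
                          else (if d then bit01 (β false true) else bit01 (β false false))) ≡ bit01 (β c d)
    value true true = refl
    value true false = refl
    value false true = refl
    value false false = refl

  oddR : ∀ {n} {a : Vec ℕ n → ℕ} → Rec a → Recᵇ (λ xs → odd (a xs))
  oddR {a = a} ra = cast (λ xs → value (a xs)) (natrecR zeroR (∸R (constR 1) x₀) ra)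
    where
    flipped : ∀ b → 1 ∸ bit01 b ≡ bit01 (not b)
    flipped true = refl
    flipped false = refl
    value : ∀ n → natrec 0 (λ k r → 1 ∸ r) n ≡ bit01 (odd n)
    value zero = refl
    value (suc n) = trans (cong (1 ∸_) (value n)) (flipped (odd n))

-- Evaluation of programs with bounded search

guard : ℕ → ℕ → ℕ
guard c v = if pos c then v else 0

-- A candidate without a value yet blocks the loop rather than being skipped; otherwise more fuel
-- might reveal a smaller zero and change a value already returned.
searchStep : ℕ → ℕ → ℕ → ℕ
searchStep i r v = if pos r then r else (if pos v then (if pos (pred v) then 0 else 2 + i) else 1)

-- Evaluation with fuel s: 0 means no value yet, suc y means the value y.
-- The loop for mu is 0 while searching, 1 once stuck, and 2 + y once y is found.
mutual
  run : ∀ {n} → MuR NoOrc n → ℕ → Vec ℕ n → ℕ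
  run zer s xs = 1
  run succ s (x ∷ []) = 2 + x
  run (proj i) s xs = suc (lookup xs i)
  run (comp f gs) s xs = guard (allRun gs s xs) (run f s (runs gs s xs))
  run (prec g h) s (x ∷ xs) = natrec (run g s xs) (λ k r → guard r (run h s (pred r ∷ k ∷ xs))) x
  -- `pred` identifies "searching" and "stuck" as "no value yet" and turns the state 2 + y into the
  -- output suc y.
  run (mu f) s xs = pred (search f s xs s)
  run (orc ())

  runs : ∀ {m n} → Vec (MuR NoOrc n) m → ℕ → Vec ℕ n → Vec ℕ m
  runs [] s xs = []
  runs (g ∷ gs) s xs = pred (run g s xs) ∷ runs gs s xs

  allRun : ∀ {m n} → Vec (MuR NoOrc n) m → ℕ → Vec ℕ n → ℕ
  allRun [] s xs = 1
  allRun (g ∷ gs) s xs = guard (run g s xs) (allRun gs s xs)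

  search : ∀ {n} → MuR NoOrc (suc n) → ℕ → Vec ℕ n → ℕ → ℕ
  search f s xs = natrec 0 (λ i r → searchStep i r (run f s (i ∷ xs)))

module RunPrimRec {O : Sig} (σ : Interp O) where
  open PrimRec σ

  guardR : ∀ {n} {c a : Vec ℕ n → ℕ} → Rec c → Rec a → Rec (λ xs → guard (c xs) (a xs))
  guardR rc ra = ifR (posR rc) ra zeroR

  mutual
    -- The fuel is an ordinary argument, at the head of the vector, and minimisation has become a
    -- loop of that length, so bounded evaluation of a fixed program is primitive recursive.
    runR : ∀ {n} (t : MuR NoOrc n) → Rec (λ v → run t (head v) (tail v))
    runR zer = constR 1
    runR succ = cast (λ { (s ∷ x ∷ []) → refl }) (sucR (sucR x₁))
    runR (proj i) = cast (λ { (s ∷ xs) → refl }) (sucR (varR (suc i)))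
    runR (comp f gs) = guardR (allRunR gs) (app (runR f) (cast₀ ∷R runsR gs))
      where
      cast₀ : ∀ {n} → Rec {suc n} head
      cast₀ = cast (λ { (s ∷ xs) → refl }) x₀
    runR (prec g h) = cast (λ { (s ∷ x ∷ xs) → refl })
      (natrecR (app (runR g) (x₀ ∷R dropR 2))
        (guardR x₀ (app (runR h) (x₂ ∷R predR x₀ ∷R x₁ ∷R dropR 4))) x₁)
    runR (mu f) = cast (λ { (s ∷ xs) → refl })
      (predR (natrecR zeroR
        (ifR (posR x₀) x₀ (ifR (posR step) (ifR (posR (predR step)) zeroR (sucR (sucR x₁))) (constR 1))) x₀))
      where
      step = app (runR f) (x₂ ∷R x₁ ∷R dropR 3)
    runR (orc ())

    runsR : ∀ {m n} (gs : Vec (MuR NoOrc n) m) → RecV (λ v → runs gs (head v) (tail v))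
    runsR [] = []R
    runsR (g ∷ gs) = predR (runR g) ∷R runsR gs

    allRunR : ∀ {m n} (gs : Vec (MuR NoOrc n) m) → Rec (λ v → allRun gs (head v) (tail v))
    allRunR [] = constR 1
    allRunR (g ∷ gs) = guardR (runR g) (allRunR gs)

guard-pos : ∀ c v {y} → guard c v ≡ suc y → ∃ λ k → c ≡ suc k × v ≡ suc y
guard-pos (suc k) v e = k , refl , e

mutual
  run-mono : ∀ {n} (t : MuR NoOrc n) {s s′} xs {y} → s ≤ s′ → run t s xs ≡ suc y → run t s′ xs ≡ suc y
  run-mono zer xs le e = e
  run-mono succ (x ∷ []) le e = e
  run-mono (proj i) xs le e = e
  run-mono (comp f gs) {s} {s′} xs le e with guard-pos (allRun gs s xs) _ e
  ... | k , a , b rewrite proj₁ (runs-mono gs xs le a) | proj₂ (runs-mono gs xs le a) = run-mono f _ le b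
  run-mono (prec g h) (x ∷ xs) le e = prec-mono g h x xs le e
  run-mono (mu f) {s} {s′} xs {y} le e = cong pred
    (search-stop f s′ xs le (proj₂ (search-mono f xs le s) y (suc-pred-≡ e)))
    where
    suc-pred-≡ : ∀ {a b} → pred a ≡ suc b → a ≡ 2 + b
    suc-pred-≡ {suc a} e = cong suc e
  run-mono (orc ())

  runs-mono : ∀ {m n} (gs : Vec (MuR NoOrc n) m) {s s′} xs {y} → s ≤ s′ → allRun gs s xs ≡ suc y →
              allRun gs s′ xs ≡ suc y × runs gs s′ xs ≡ runs gs s xs
  runs-mono [] xs le e = e , refl
  runs-mono (g ∷ gs) {s} {s′} xs le e with guard-pos (run g s xs) _ e
  ... | k , a , b rewrite run-mono g xs le a | a with runs-mono gs xs le b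
  ... | c , d = c , cong (k ∷_) d

  prec-mono : ∀ {n} (g : MuR NoOrc n) h {s s′} x xs {y} → s ≤ s′ →
              run (prec g h) s (x ∷ xs) ≡ suc y → run (prec g h) s′ (x ∷ xs) ≡ suc y
  prec-mono g h zero xs le e = run-mono g xs le e
  prec-mono g h {s} (suc x) xs le e with guard-pos (run (prec g h) s (x ∷ xs)) _ e
  ... | k , a , b rewrite prec-mono g h x xs le a | a = run-mono h _ le b

  -- Only the states "searching" and "found" persist when fuel is added; a stuck search may come
  -- unstuck, so state 1 is left out.
  search-mono : ∀ {n} (f : MuR NoOrc (suc n)) {s s′} xs → s ≤ s′ → ∀ i →
                (search f s xs i ≡ 0 → search f s′ xs i ≡ 0) ×
                (∀ y → search f s xs i ≡ 2 + y → search f s′ xs i ≡ 2 + y)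
  search-mono f xs le zero = id , λ y ()
  search-mono f {s} {s′} xs le (suc i) with search f s xs i in r | search-mono f xs le i
  ... | suc zero | _ = (λ ()) , λ y ()
  ... | suc (suc k) | _ , found rewrite found k refl = (λ ()) , λ y e → e
  ... | zero | still , _ rewrite still refl with run f s (i ∷ xs) in v
  ... | zero = (λ ()) , λ y ()
  ... | suc zero rewrite run-mono f (i ∷ xs) le v = id , λ y e → e
  ... | suc (suc k) rewrite run-mono f (i ∷ xs) le v = id , λ y ()

  search-stop : ∀ {n} (f : MuR NoOrc (suc n)) s xs {i j y} → i ≤ j →
                search f s xs i ≡ 2 + y → search f s xs j ≡ 2 + y
  search-stop f s xs {i} {j} le e = go (≤⇒≤′ le)
    where
    go : ∀ {j} → i ≤′ j → search f s xs j ≡ 2 + _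
    go ≤′-refl = e
    go (≤′-step p) rewrite go p = refl

-- Finitely many monotone bounds are dominated by their sum. It serves for the fuel of a search and
-- again for the oracle use of one.
uniform : ∀ {P : ℕ → ℕ → Set} → (∀ z {s s′} → s ≤ s′ → P z s → P z s′) →
          ∀ y → (∀ z → z < y → ∃ (P z)) → ∃ λ s → ∀ z → z < y → P z s
uniform mono zero h = 0 , λ z ()
uniform {P} mono (suc y) h with uniform {P} mono y (λ z z<y → h z (m≤n⇒m≤1+n z<y)) | h y (n<1+n y)
... | s , p | s′ , q = s + s′ , λ z z<1+y → case m≤n⇒m<n∨m≡n (s≤s⁻¹ z<1+y) of λ
  { (inj₁ z<y) → mono z (m≤m+n s s′) (p z z<y)
  ; (inj₂ refl) → mono y (m≤n+m s′ s) q }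

mutual
  run-complete : ∀ {n} {t : MuR NoOrc n} {xs y} → _⇓_ noOrc (t , xs) y → ∃ λ s → run t s xs ≡ suc y
  run-complete ev-zer = 0 , refl
  run-complete ev-succ = 0 , refl
  run-complete ev-proj = 0 , refl
  run-complete {t = comp f gs} {xs} (ev-comp {ys = ys} ds d) with runs-complete ds | run-complete d
  ... | s , k , a , b | s′ , c = s + s′ , lemma
    where
    lemma : run (comp f gs) (s + s′) xs ≡ suc _
    lemma = trans
      (cong₂ guard (proj₁ (runs-mono gs xs (m≤m+n s s′) a))
        (cong (run f (s + s′)) (trans (proj₂ (runs-mono gs xs (m≤m+n s s′) a)) b)))
      (run-mono f ys (m≤n+m s′ s) c)
  run-complete (ev-prec0 d) = run-complete d
  run-complete {t = prec g h} (ev-precS {xs = xs} {k} d d′) with run-complete d | run-complete d′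
  ... | s , a | s′ , b = s + s′ , lemma
    where
    lemma : run (prec g h) (s + s′) (suc k ∷ xs) ≡ suc _
    lemma rewrite prec-mono g h k xs (m≤m+n s s′) a = run-mono h _ (m≤n+m s′ s) b
  run-complete {t = mu f} {xs} {y} (ev-mu d ds) with run-complete d
    | uniform {λ z s → ∃ λ k → run f s (z ∷ xs) ≡ 2 + k} (λ z le (k , e) → k , run-mono f _ le e) y
        (λ z z<y → below z z<y)
    where
    below : ∀ z → z < y → ∃ λ s → ∃ λ k → run f s (z ∷ xs) ≡ 2 + k
    below z z<y with ds z z<y
    ... | k , d′ with run-complete d′
    ... | s , e = s , k , e
  ... | s₁ , a | s₂ , b = s , cong pred (search-stop f s xs {suc y} y<s found)
    where
    -- The fuel is also the length of the search loop, so it must exceed `y` as well as suffice for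
    -- evaluating each candidate.
    s = suc y + (s₁ + s₂)
    y<s : y < s
    y<s = m≤m+n (suc y) _
    searching : ∀ i → i ≤ y → search f s xs i ≡ 0
    searching zero _ = refl
    searching (suc i) i<y rewrite searching i (<⇒≤ i<y)
      | run-mono f {s₂} {s} (i ∷ xs) (≤-trans (m≤n+m s₂ s₁) (m≤n+m _ (suc y))) (proj₂ (b i i<y)) = refl
    found : search f s xs (suc y) ≡ 2 + y
    found rewrite searching y ≤-refl | run-mono f {s₁} {s} (y ∷ xs) (≤-trans (m≤m+n s₁ s₂) (m≤n+m _ (suc y))) a = refl

  runs-complete : ∀ {m n} {gs : Vec (MuR NoOrc n) m} {xs ys} → _⇓s_ noOrc (gs , xs) ys →
                  ∃ λ s → ∃ λ k → allRun gs s xs ≡ suc k × runs gs s xs ≡ ys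
  runs-complete evs-[] = 0 , 0 , refl , refl
  runs-complete {gs = g ∷ gs} {xs} (evs-∷ d ds) with run-complete d | runs-complete ds
  ... | s , a | s′ , k , b , c = s + s′ , k , lemma , lemma′
    where
    lemma : allRun (g ∷ gs) (s + s′) xs ≡ suc k
    lemma rewrite run-mono g xs (m≤m+n s s′) a = proj₁ (runs-mono gs xs (m≤n+m s′ s) b)
    lemma′ : runs (g ∷ gs) (s + s′) xs ≡ _
    lemma′ rewrite run-mono g xs (m≤m+n s s′) a = cong (_ ∷_) (trans (proj₂ (runs-mono gs xs (m≤n+m s′ s) b)) c)

-- Tree algebras

-- Counts the odd numbers below its argument, which gives the rounded-down half by plain recursion.
half : ℕ → ℕ
half = natrec 0 (λ k r → bit01 (odd k) + r)

not-not : ∀ b → not (not b) ≡ b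
not-not true = refl
not-not false = refl

half-2+ : ∀ n → half (2 + n) ≡ suc (half n)
half-2+ n with odd n
... | true = refl
... | false = refl

half-≤ : ∀ n → half n ≤ n
half-≤ zero = z≤n
half-≤ (suc zero) = z≤n
half-≤ (suc (suc n)) rewrite half-2+ n = s≤s (m≤n⇒m≤1+n (half-≤ n))

half-≤-pred : ∀ n → half n ≤ pred n
half-≤-pred zero = z≤n
half-≤-pred (suc zero) = z≤n
half-≤-pred (suc (suc n)) rewrite half-2+ n = s≤s (half-≤ n)

half-double : ∀ r → half (r + r) ≡ r
half-double zero = refl
half-double (suc r) rewrite +-suc r r = trans (half-2+ (r + r)) (cong suc (half-double r))

odd-double : ∀ r → odd (r + r) ≡ false
odd-double zero = refl
odd-double (suc r) rewrite +-suc r r = trans (not-not _) (odd-double r)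

odd-bit : ∀ b r → odd (bit01 b + (r + r)) ≡ b
odd-bit true r = cong not (odd-double r)
odd-bit false r = odd-double r

half-bit : ∀ b r → half (bit01 b + (r + r)) ≡ r
half-bit true r = trans (cong (λ c → bit01 c + half (r + r)) (odd-double r)) (half-double r)
half-bit false r = half-double r

binary : ∀ n → n ≡ bit01 (odd n) + (half n + half n)
binary zero = refl
binary (suc zero) = refl
binary (suc (suc n)) rewrite half-2+ n | not-not (odd n) =
  trans (cong (2 +_) (binary n)) (shuffle (bit01 (odd n)) (half n))
  where
  shuffle : ∀ b h → 2 + (b + (h + h)) ≡ b + (suc h + suc h)
  shuffle b h = trans (cong suc (sym (+-suc b (h + h))))
    (trans (sym (+-suc b _)) (cong (λ z → b + suc z) (sym (+-suc h h))))

shift : ℕ → ℕ → ℕ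
shift m x = natrec x (λ _ r → half r) m

bit : ℕ → ℕ → Bool
bit m x = odd (shift m x)

shift-half : ∀ m x → shift m (half x) ≡ half (shift m x)
shift-half zero x = refl
shift-half (suc m) x = cong half (shift-half m x)

bit-half : ∀ m x → bit (suc m) x ≡ bit m (half x)
bit-half m x = cong odd (sym (shift-half m x))

shift-≤ : ∀ m x → shift m x ≤ x ∸ m
shift-≤ zero x = ≤-refl
shift-≤ (suc m) x = ≤-trans (half-≤-pred (shift m x))
  (≤-trans (pred-mono-≤ (shift-≤ m x)) (≤-reflexive (pred[m∸n]≡m∸[1+n] x m)))

bit-high : ∀ m x → x ≤ m → bit m x ≡ false
bit-high m x x≤m = cong odd (n≤0⇒n≡0 (≤-trans (shift-≤ m x) (≤-reflexive (m≤n⇒m∸n≡0 x≤m))))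

bits-injective : ∀ x y → (∀ m → bit m x ≡ bit m y) → x ≡ y
bits-injective x y = go (x + y) x y (m≤m+n x y) (m≤n+m y x)
  where
  go : ∀ N x y → x ≤ N → y ≤ N → (∀ m → bit m x ≡ bit m y) → x ≡ y
  go zero zero zero _ _ h = refl
  go (suc N) x y x≤N y≤N h = trans (binary x) (trans
    (cong₂ (λ b z → bit01 b + (z + z)) (h 0) (go N (half x) (half y) (small x≤N) (small y≤N)
      λ m → trans (sym (bit-half m x)) (trans (h (suc m)) (bit-half m y))))
    (sym (binary y)))
    where
    small : ∀ {z} → z ≤ suc N → half z ≤ N
    small {z} z≤N = ≤-trans (half-≤-pred z) (pred-mono-≤ z≤N)

bit-cons-zero : ∀ b r → bit 0 (bit01 b + (r + r)) ≡ b
bit-cons-zero = odd-bit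

bit-cons-suc : ∀ m b r → bit (suc m) (bit01 b + (r + r)) ≡ bit m r
bit-cons-suc m b r = trans (bit-half m _) (cong (bit m) (half-bit b r))

-- Horner's scheme from the top digit downwards: after `i` steps it has consumed the digits with
-- indices from N ∸ i to N ∸ 1.
encodeTop : (ℕ → Bool) → ℕ → ℕ → ℕ
encodeTop δ N = natrec 0 (λ i r → bit01 (δ (N ∸ suc i)) + (r + r))

encode : (ℕ → Bool) → ℕ → ℕ
encode δ N = encodeTop δ N N

bit-0 : ∀ m → bit m 0 ≡ false
bit-0 m = bit-high m 0 z≤n

bit-encodeTop : ∀ δ N → (∀ m → N ≤ m → δ m ≡ false) → ∀ i → i ≤ N → ∀ m →
                bit m (encodeTop δ N i) ≡ δ (N ∸ i + m)
bit-encodeTop δ N high zero _ m = trans (bit-0 m) (sym (high (N + m) (m≤m+n N m)))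
bit-encodeTop δ N high (suc i) i<N zero =
  trans (bit-cons-zero (δ (N ∸ suc i)) (encodeTop δ N i)) (cong δ (sym (+-identityʳ _)))
bit-encodeTop δ N high (suc i) i<N (suc m) =
  trans (bit-cons-suc m (δ (N ∸ suc i)) (encodeTop δ N i)) (trans (bit-encodeTop δ N high i (<⇒≤ i<N) m)
    (cong δ (trans (cong (_+ m) (+-∸-assoc 1 i<N)) (sym (+-suc (N ∸ suc i) m)))))

bit-encode : ∀ δ N → (∀ m → N ≤ m → δ m ≡ false) → ∀ m → bit m (encode δ N) ≡ δ m
bit-encode δ N high m = trans (bit-encodeTop δ N high N ≤-refl m) (cong (λ z → δ (z + m)) (n∸n≡0 N))

pow2 : ℕ → ℕ
pow2 = natrec 1 (λ _ r → r + r)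

bit-pow2-same : ∀ p → bit p (pow2 p) ≡ true
bit-pow2-same zero = refl
bit-pow2-same (suc p) = trans (bit-cons-suc p false (pow2 p)) (bit-pow2-same p)

bit-pow2-other : ∀ q p → q ≢ p → bit q (pow2 p) ≡ false
bit-pow2-other zero zero q≢p = ⊥-elim (q≢p refl)
bit-pow2-other (suc q) zero _ = trans (bit-half q 1) (bit-0 q)
bit-pow2-other zero (suc p) _ = odd-double (pow2 p)
bit-pow2-other (suc q) (suc p) q≢p = trans (bit-cons-suc q false (pow2 p)) (bit-pow2-other q p (q≢p ∘ cong suc))

same : ℕ → ℕ → Bool
same a b = not (pos ((a ∸ b) + (b ∸ a)))

same-refl : ∀ a → same a a ≡ true
same-refl a rewrite n∸n≡0 a = refl

same-< : ∀ {a b} → a < b → same a b ≡ false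
same-< {zero} {suc b} a<b = refl
same-< {suc a} {suc b} (s≤s a<b) = same-< a<b

-- ℕ is cut into the blocks [blk s, blk (1+s)) of length 1 + blk s, and dec m is the
-- position of m in its block; so dec takes every value infinitely often.
blk : ℕ → ℕ
blk = natrec 0 (λ _ r → suc (r + r))

-- A block that starts at r has r + 1 members and so ends at r + r; the start jumps exactly after
-- that index.
blockStart : ℕ → ℕ
blockStart = natrec 0 (λ m r → if same m (r + r) then suc m else r)

dec : ℕ → ℕ
dec m = m ∸ blockStart m

≤-blk : ∀ s → s ≤ blk s
≤-blk zero = z≤n
≤-blk (suc s) = s≤s (≤-trans (≤-blk s) (m≤m+n _ _))

mutual
  blockStart-blk : ∀ s → blockStart (blk s) ≡ blk s
  blockStart-blk zero = refl
  blockStart-blk (suc s) rewrite blockStart-in s (blk s) ≤-refl | same-refl (blk s + blk s) = refl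

  blockStart-in : ∀ s i → i ≤ blk s → blockStart (blk s + i) ≡ blk s
  blockStart-in s zero _ = trans (cong blockStart (+-identityʳ (blk s))) (blockStart-blk s)
  blockStart-in s (suc i) i<b rewrite +-suc (blk s) i | blockStart-in s i (<⇒≤ i<b)
    | same-< (+-monoʳ-< (blk s) i<b) = refl

dec-blk : ∀ s i → i ≤ blk s → dec (blk s + i) ≡ i
dec-blk s i i≤b rewrite blockStart-in s i i≤b = m+n∸m≡n (blk s) i

+-swap : ∀ a b c → a + (b + c) ≡ b + (a + c)
+-swap a b c = trans (sym (+-assoc a b c)) (trans (cong (_+ c) (+-comm a b)) (+-assoc b a c))

xor-cancelʳ : ∀ a b c → a xor c ≡ b xor c → a ≡ b
xor-cancelʳ true true c e = refl
xor-cancelʳ false false c e = refl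
xor-cancelʳ true false true ()
xor-cancelʳ true false false ()
xor-cancelʳ false true true ()
xor-cancelʳ false true false ()

xor-same : ∀ a → a xor a ≡ false
xor-same true = refl
xor-same false = refl

xor-xor : ∀ a b → (a xor b) xor b ≡ a
xor-xor true true = refl
xor-xor true false = refl
xor-xor false true = refl
xor-xor false false = refl

odd-+ : ∀ a b → odd (a + b) ≡ odd a xor odd b
odd-+ zero b = refl
odd-+ (suc a) b with odd a | odd-+ a b
... | true | e = trans (cong not e) (not-not (odd b))
... | false | e = cong not e

odd-bit01 : ∀ b → odd (bit01 b) ≡ b
odd-bit01 true = refl
odd-bit01 false = refl

pos-true : ∀ n → pos n ≡ true → 0 < n
pos-true (suc n) e = s≤s z≤n

pos-∸ : ∀ {m n} → m < n → pos (n ∸ m) ≡ true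
pos-∸ {zero} {suc n} _ = refl
pos-∸ {suc m} {suc n} (s≤s m<n) = pos-∸ m<n

bool-ext : ∀ a b → (a ≡ true → b ≡ true) → (b ≡ true → a ≡ true) → a ≡ b
bool-ext true b f g = sym (f refl)
bool-ext false true f g = g refl
bool-ext false false f g = refl

true≢false : ∀ {b} → b ≡ true → b ≡ false → ⊥
true≢false refl ()

bool-split : ∀ b → b ≡ true ⊎ b ≡ false
bool-split true = inj₁ refl
bool-split false = inj₂ refl

-- The nodes ℕ form a tree with root 0 and parent function par. The algebra consists of the maps
-- v : ℕ → Bool with v m ≡ v (par m) for all but finitely many m; the number x codes the map ev x
-- that differs at m from its value at par m exactly when the m-th binary digit of x is 1 (with
-- value bit 0 x at the root). Nodes 1 .. k stay leaves, and p > k may receive m as a child only if al m p.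
module TreeAlgebra (k : ℕ) (al : ℕ → ℕ → Bool) where

  par : ℕ → ℕ
  par m = if (pos (m ∸ dec m) ∧ pos (dec m ∸ k)) ∧ al m (dec m) then dec m else 0

  par-pos : ∀ m {p} → 0 < p → par m ≡ p → p < m × k < p × al m p ≡ true
  par-pos m {p} 0<p e with (pos (m ∸ dec m) ∧ pos (dec m ∸ k)) ∧ al m (dec m) in c
  ... | false = ⊥-elim (<⇒≢ 0<p e)
  ... | true rewrite e with ∧-true (pos (m ∸ p) ∧ pos (p ∸ k)) _ c
  ... | c₁ , c₂ with ∧-true (pos (m ∸ p)) _ c₁
  ... | c₃ , c₄ = m∸n≢0⇒n<m (>⇒≢ (pos-true _ c₃)) , m∸n≢0⇒n<m (>⇒≢ (pos-true _ c₄)) , c₂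

  par-inner : ∀ m → par m ≡ 0 ⊎ k < par m
  par-inner m with par m in e
  ... | zero = inj₁ refl
  ... | suc p = inj₂ (proj₁ (proj₂ (par-pos m (s≤s z≤n) e)))

  par-< : ∀ m → par (suc m) < suc m
  par-< m with par (suc m) in e
  ... | zero = s≤s z≤n
  ... | suc p = proj₁ (par-pos (suc m) (s≤s z≤n) e)

  par-≤-pred : ∀ m → par m ≤ pred m
  par-≤-pred (suc m) = s≤s⁻¹ (par-< m)
  par-≤-pred zero with par zero in e
  ... | zero = z≤n
  ... | suc p = ⊥-elim (n≮0 (proj₁ (par-pos zero (s≤s z≤n) e)))

  par-blk : ∀ s p → p ≤ s → 0 < s → p ≡ 0 ⊎ k < p → al (blk s + p) p ≡ true → par (blk s + p) ≡ p
  par-blk s p p≤s 0<s inner a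
    rewrite dec-blk s p (≤-trans p≤s (≤-blk s)) | a | m+n∸n≡m (blk s) p with inner
  ... | inj₁ refl with (pos (blk s) ∧ pos (0 ∸ k)) ∧ true
  ... | true = refl
  ... | false = refl
  par-blk s p p≤s 0<s inner a | inj₂ k<p
    rewrite pos-∸ k<p | pos-∸ {0} (≤-trans 0<s (≤-blk s)) = refl

  anc : ℕ → ℕ → ℕ
  anc j m = natrec m (λ _ r → par r) j

  -- The root is excluded because the chain of ancestors, followed for a fixed number of steps, may
  -- stay at 0 for long; the digit of the root is counted once, in `ev`.
  mark : ℕ → ℕ → ℕ
  mark x m = if pos m then bit01 (bit m x) else 0

  marks : ℕ → ℕ → ℕ → ℕ
  marks x m = natrec 0 (λ j r → mark x (anc j m) + r)

  opaque
    ev : ℕ → ℕ → Bool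
    ev x m = odd (bit01 (bit 0 x) + marks x m m)

  anc-par : ∀ j m → anc j (par m) ≡ anc (suc j) m
  anc-par zero m = refl
  anc-par (suc j) m = cong par (anc-par j m)

  anc-≤ : ∀ j m → anc j m ≤ m ∸ j
  anc-≤ zero m = ≤-refl
  anc-≤ (suc j) m = ≤-trans (par-≤-pred (anc j m))
    (≤-trans (pred-mono-≤ (anc-≤ j m)) (≤-reflexive (pred[m∸n]≡m∸[1+n] m j)))

  marks-par : ∀ x m n → marks x m (suc n) ≡ mark x m + marks x (par m) n
  marks-par x m zero = refl
  marks-par x m (suc n) = trans (cong₂ (λ a b → mark x a + b) (sym (anc-par n m)) (marks-par x m n))
    (+-swap (mark x (anc n (par m))) (mark x m) _)

  marks-stable : ∀ x m {n} → m ≤′ n → marks x m n ≡ marks x m m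
  marks-stable x m ≤′-refl = refl
  marks-stable x m {suc n} (≤′-step m≤n)
    rewrite n≤0⇒n≡0 (≤-trans (anc-≤ n m) (≤-reflexive (m≤n⇒m∸n≡0 (≤′⇒≤ m≤n)))) = marks-stable x m m≤n

  opaque
    unfolding ev

    ev-zero : ∀ x → ev x 0 ≡ bit 0 x
    ev-zero x = trans (cong odd (+-identityʳ (bit01 (bit 0 x)))) (odd-bit01 (bit 0 x))

    ev-suc : ∀ x m → ev x (suc m) ≡ bit (suc m) x xor ev x (par (suc m))
    ev-suc x m = begin
      odd (b₀ + marks x (suc m) (suc m))                     ≡⟨ cong (λ z → odd (b₀ + z)) (marks-par x (suc m) m) ⟩
      odd (b₀ + (b₁ + marks x (par (suc m)) m))              ≡⟨ cong (λ z → odd (b₀ + (b₁ + z)))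
                                                                  (marks-stable x _ (≤⇒≤′ (par-≤-pred (suc m)))) ⟩
      odd (b₀ + (b₁ + marks x (par (suc m)) (par (suc m))))  ≡⟨ cong odd (+-swap b₀ b₁ _) ⟩
      odd (b₁ + (b₀ + marks x (par (suc m)) (par (suc m))))  ≡⟨ odd-+ b₁ _ ⟩
      odd b₁ xor ev x (par (suc m))                          ≡⟨ cong (_xor ev x (par (suc m))) (odd-bit01 (bit (suc m) x)) ⟩
      bit (suc m) x xor ev x (par (suc m))                   ∎
      where
      open ≡-Reasoning
      b₀ b₁ : ℕ
      b₀ = bit01 (bit 0 x)
      b₁ = bit01 (bit (suc m) x)

  ev-high : ∀ x m → x ≤ m → 0 < m → ev x m ≡ ev x (par m)
  ev-high x (suc m) x≤m _ = trans (ev-suc x m) (cong (_xor ev x (par (suc m))) (bit-high (suc m) x x≤m))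

  par-induction : (P : ℕ → Set) → P 0 → (∀ m → P (par (suc m)) → P (suc m)) → ∀ m → P m
  par-induction P base step m = go m m ≤-refl
    where
    go : ∀ N m → m ≤ N → P m
    go N zero _ = base
    go (suc N) (suc m) m≤N = step m (go N (par (suc m)) (≤-trans (par-≤-pred (suc m)) (s≤s⁻¹ m≤N)))

  ev-ext : ∀ {x y} → (∀ m → ev x m ≡ ev y m) → x ≡ y
  ev-ext {x} {y} h = bits-injective x y bits
    where
    bits : ∀ m → bit m x ≡ bit m y
    bits zero = trans (sym (ev-zero x)) (trans (h 0) (ev-zero y))
    bits (suc m) = xor-cancelʳ _ _ (ev x (par (suc m))) (trans (sym (ev-suc x m))
      (trans (h (suc m)) (trans (ev-suc y m) (cong (bit (suc m) y xor_) (sym (h (par (suc m))))))))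

  pointwise : (Bool → Bool → Bool) → ℕ → ℕ → ℕ → Bool
  pointwise β x y m = β (ev x m) (ev y m)

  -- The inverse of the passage from digits to maps: the digit at a node is the difference between
  -- its value and the value of its parent, and at the root the value itself.
  digit : (Bool → Bool → Bool) → ℕ → ℕ → ℕ → Bool
  digit β x y m = pointwise β x y m xor (pos m ∧ pointwise β x y (par m))

  opaque
    op : (Bool → Bool → Bool) → ℕ → ℕ → ℕ
    op β x y = encode (digit β x y) (suc (x + y))

    -- From index suc (x + y) on both arguments copy the values of parents, hence so does the
    -- result, and the digits cut off by `encode` are zero.
    bit-op : ∀ β x y m → bit m (op β x y) ≡ digit β x y m
    bit-op β x y = bit-encode (digit β x y) (suc (x + y)) high
      where
      high : ∀ m → suc (x + y) ≤ m → digit β x y m ≡ false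
      high (suc m) h rewrite ev-high x (suc m) (≤-trans (m≤m+n x y) (<⇒≤ h)) (s≤s z≤n)
        | ev-high y (suc m) (≤-trans (m≤n+m y x) (<⇒≤ h)) (s≤s z≤n) = xor-same (pointwise β x y (par (suc m)))

  ev-op : ∀ β x y m → ev (op β x y) m ≡ β (ev x m) (ev y m)
  ev-op β x y = par-induction _
    (trans (ev-zero (op β x y)) (trans (bit-op β x y 0) (xor-false _)))
    λ m ih → trans (ev-suc (op β x y) m)
      (trans (cong₂ _xor_ (bit-op β x y (suc m)) ih) (xor-xor (pointwise β x y (suc m)) _))
    where
    xor-false : ∀ a → a xor false ≡ a
    xor-false true = refl
    xor-false false = refl

  algebra : Str
  algebra = record
    { join = op _∨_ ; meet = op _∧_ ; compl = λ x → op (λ a _ → not a) x x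
    ; top = op (λ _ _ → true) 0 0 ; bot = op (λ _ _ → false) 0 0 }

  ev-meet : ∀ x y m → ev (meet algebra x y) m ≡ ev x m ∧ ev y m
  ev-meet = ev-op _∧_
  ev-join : ∀ x y m → ev (join algebra x y) m ≡ ev x m ∨ ev y m
  ev-join = ev-op _∨_
  ev-compl : ∀ x m → ev (compl algebra x) m ≡ not (ev x m)
  ev-compl x = ev-op (λ a _ → not a) x x
  ev-top : ∀ m → ev (top algebra) m ≡ true
  ev-top = ev-op (λ _ _ → true) 0 0
  ev-bot : ∀ m → ev (bot algebra) m ≡ false
  ev-bot = ev-op (λ _ _ → false) 0 0

  isBooleanAlgebra : IsBA algebra
  isBooleanAlgebra = record
    { isDistributiveLattice = record
      { isLattice = record
        { isEquivalence = isEquivalence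
        ; ∨-comm = λ x y → ev-ext λ m → lift₂ _∨_ _∨_ x y y x m (∨-comm (ev x m) (ev y m))
        ; ∨-assoc = λ x y z → ev-ext λ m → trans (ev-join _ z m) (trans (cong (_∨ ev z m) (ev-join x y m))
            (trans (∨-assoc (ev x m) _ _) (sym (trans (ev-join x _ m) (cong (ev x m ∨_) (ev-join y z m))))))
        ; ∨-cong = cong₂ _
        ; ∧-comm = λ x y → ev-ext λ m → lift₂ _∧_ _∧_ x y y x m (∧-comm (ev x m) (ev y m))
        ; ∧-assoc = λ x y z → ev-ext λ m → trans (ev-meet _ z m) (trans (cong (_∧ ev z m) (ev-meet x y m))
            (trans (∧-assoc (ev x m) _ _) (sym (trans (ev-meet x _ m) (cong (ev x m ∧_) (ev-meet y z m))))))
        ; ∧-cong = cong₂ _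
        ; absorptive =
            (λ x y → ev-ext λ m → trans (ev-join x _ m) (trans (cong (ev x m ∨_) (ev-meet x y m)) (∨-abs-∧ (ev x m) (ev y m)))) ,
            (λ x y → ev-ext λ m → trans (ev-meet x _ m) (trans (cong (ev x m ∧_) (ev-join x y m)) (∧-abs-∨ (ev x m) (ev y m))))
        }
      ; ∨-distrib-∧ = distrib _∨_ _∧_ ∨-distribˡ-∧ ∨-distribʳ-∧
      ; ∧-distrib-∨ = distrib _∧_ _∨_ ∧-distribˡ-∨ ∧-distribʳ-∨
      }
    ; ∨-complement =
        (λ x → ev-ext λ m → trans (ev-join _ x m) (trans (cong (_∨ ev x m) (ev-compl x m)) (trans (∨-inverseˡ (ev x m)) (sym (ev-top m))))) ,
        (λ x → ev-ext λ m → trans (ev-join x _ m) (trans (cong (ev x m ∨_) (ev-compl x m)) (trans (∨-inverseʳ (ev x m)) (sym (ev-top m)))))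
    ; ∧-complement =
        (λ x → ev-ext λ m → trans (ev-meet _ x m) (trans (cong (_∧ ev x m) (ev-compl x m)) (trans (∧-inverseˡ (ev x m)) (sym (ev-bot m))))) ,
        (λ x → ev-ext λ m → trans (ev-meet x _ m) (trans (cong (ev x m ∧_) (ev-compl x m)) (trans (∧-inverseʳ (ev x m)) (sym (ev-bot m)))))
    ; ¬-cong = cong (compl algebra)
    }
    where
    open import Data.Bool.Properties
      using (∨-comm; ∨-assoc; ∧-comm; ∧-assoc; ∨-abs-∧; ∧-abs-∨; ∨-inverseˡ; ∨-inverseʳ; ∧-inverseˡ; ∧-inverseʳ
            ; ∨-distribˡ-∧; ∨-distribʳ-∧; ∧-distribˡ-∨; ∧-distribʳ-∨)
    lift₂ : ∀ β γ x y z w m → β (ev x m) (ev y m) ≡ γ (ev z m) (ev w m) → ev (op β x y) m ≡ ev (op γ z w) m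
    lift₂ β γ x y z w m e = trans (ev-op β x y m) (trans e (sym (ev-op γ z w m)))
    distrib : ∀ β γ → (∀ a b c → β a (γ b c) ≡ γ (β a b) (β a c)) → (∀ a b c → β (γ b c) a ≡ γ (β b a) (β c a)) →
              (∀ x y z → op β x (op γ y z) ≡ op γ (op β x y) (op β x z)) ×
              (∀ x y z → op β (op γ y z) x ≡ op γ (op β y x) (op β z x))
    distrib β γ l r =
      (λ x y z → ev-ext λ m → trans (ev-op β x _ m) (trans (cong (β (ev x m)) (ev-op γ y z m))
        (trans (l _ _ _) (sym (trans (ev-op γ _ _ m) (cong₂ γ (ev-op β x y m) (ev-op β x z m))))))) ,
      (λ x y z → ev-ext λ m → trans (ev-op β _ x m) (trans (cong (λ b → β b (ev x m)) (ev-op γ y z m))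
        (trans (r _ _ _) (sym (trans (ev-op γ _ _ m) (cong₂ γ (ev-op β y x m) (ev-op β z x m)))))))

  below⇒ev : ∀ {x y} → Below algebra x y → ∀ m → ev x m ≡ true → ev y m ≡ true
  below⇒ev {x} {y} x≤y m e =
    proj₂ (∧-true (ev x m) _ (trans (sym (ev-meet x y m)) (trans (cong (λ z → ev z m) x≤y) e)))

  ev⇒below : ∀ {x y} → (∀ m → ev x m ≡ true → ev y m ≡ true) → Below algebra x y
  ev⇒below {x} {y} h = ev-ext λ m → trans (ev-meet x y m) (meet-left (ev x m) (h m))
    where
    meet-left : ∀ a {b} → (a ≡ true → b ≡ true) → a ∧ b ≡ a
    meet-left true f = f refl
    meet-left false f = refl

  ev⇒≢bot : ∀ {x} m → ev x m ≡ true → x ≢ bot algebra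
  ev⇒≢bot m e refl = true≢false e (ev-bot m)

  -- Beyond `x` every node copies its parent, so a map that vanishes up to `x` vanishes everywhere.
  -- The bound on `p` is what later turns the search for a split into a bounded one.
  inhabited : ∀ {x} → x ≢ bot algebra → ∃ λ p → p ≤ x × ev x p ≡ true
  inhabited {x} x≢⊥ with anyUpTo? (λ p → ev x p ≟ᵇ true) (suc x)
  ... | yes (p , p<1+x , e) = p , s≤s⁻¹ p<1+x , e
  ... | no none = ⊥-elim (x≢⊥ (ev-ext λ m → trans (vanish m) (sym (ev-bot m))))
    where
    low : ∀ m → m ≤ x → ev x m ≡ false
    low m m≤x with ev x m in e
    ... | true = ⊥-elim (none (m , s≤s m≤x , e))
    ... | false = refl
    vanish : ∀ m → ev x m ≡ false
    vanish = par-induction _ (low 0 z≤n) step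
      where
      step : ∀ m → ev x (par (suc m)) ≡ false → ev x (suc m) ≡ false
      step m ih with <-≤-connex x (suc m)
      ... | inj₁ x<1+m = trans (ev-high x (suc m) (<⇒≤ x<1+m) (s≤s z≤n)) ih
      ... | inj₂ 1+m≤x = low (suc m) 1+m≤x

  -- The set of descendants of p.
  cone : ℕ → ℕ
  cone = pow2

  cone-low : ∀ {p} q → q < p → ev (cone p) q ≡ false
  cone-low {p} = par-induction _
    (λ 0<p → trans (ev-zero (cone p)) (bit-pow2-other 0 p (<⇒≢ 0<p)))
    λ m ih m<p → trans (ev-suc (cone p) m)
      (cong₂ _xor_ (bit-pow2-other (suc m) p (<⇒≢ m<p)) (ih (<-trans (par-< m) m<p)))

  cone-self : ∀ p → ev (cone p) p ≡ true
  cone-self zero = trans (ev-zero 1) refl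
  cone-self (suc p) = trans (ev-suc (cone (suc p)) p)
    (cong₂ _xor_ (bit-pow2-same (suc p)) (cone-low (par (suc p)) (par-< p)))

  cone-high : ∀ {p} q → p < q → ev (cone p) q ≡ ev (cone p) (par q)
  cone-high {p} (suc q) p<q = trans (ev-suc (cone p) q)
    (cong (_xor ev (cone p) (par (suc q))) (bit-pow2-other (suc q) p (<⇒≢ p<q ∘ sym)))

  Leaf : ℕ → Set
  Leaf p = 0 < p × p ≤ k

  -- A node that is not a leaf has a parent that is not a leaf, so its path to the root avoids `p`.
  cone-leaf-inner : ∀ {p} → Leaf p → ∀ q → q ≡ 0 ⊎ k < q → ev (cone p) q ≡ false
  cone-leaf-inner {p} (0<p , p≤k) = par-induction _ (λ _ → cone-low 0 0<p) step
    where
    step : ∀ m → (par (suc m) ≡ 0 ⊎ k < par (suc m) → ev (cone p) (par (suc m)) ≡ false) →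
           suc m ≡ 0 ⊎ k < suc m → ev (cone p) (suc m) ≡ false
    step m ih (inj₂ k<m) = trans (cone-high (suc m) (≤-<-trans p≤k k<m)) (ih (par-inner (suc m)))

  cone-leaf : ∀ {p} → Leaf p → ∀ q → ev (cone p) q ≡ true → q ≡ p
  cone-leaf {p} isLeaf q e with <-cmp q p
  ... | tri< q<p _ _ = ⊥-elim (true≢false e (cone-low q q<p))
  ... | tri≈ _ q≡p _ = q≡p
  ... | tri> _ _ p<q = ⊥-elim (true≢false (trans (sym (cone-high q p<q)) e)
                         (cone-leaf-inner isLeaf (par q) (par-inner q)))

  singleton-atom : ∀ {a} p → ev a p ≡ true → (∀ q → ev a q ≡ true → q ≡ p) → Atom algebra a
  singleton-atom {a} p ap only = ev⇒≢bot p ap , λ x x≤a → settle x x≤a (bool-split (ev x p))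
    where
    settle : ∀ x → Below algebra x a → ev x p ≡ true ⊎ ev x p ≡ false → x ≡ bot algebra ⊎ x ≡ a
    settle x x≤a (inj₁ xp) = inj₂ (ev-ext λ m → bool-ext _ _ (below⇒ev x≤a m)
      λ am → subst (λ q → ev x q ≡ true) (sym (only m am)) xp)
    settle x x≤a (inj₂ xp) = inj₁ (ev-ext λ m → bool-ext _ _
      (λ xm → ⊥-elim (true≢false (subst (λ q → ev x q ≡ true) (only m (below⇒ev x≤a m xm)) xm) xp))
      λ bm → ⊥-elim (true≢false bm (ev-bot m)))

  inner⊎leaf : ∀ p → (p ≡ 0 ⊎ k < p) ⊎ Leaf p
  inner⊎leaf zero = inj₁ (inj₁ refl)
  inner⊎leaf (suc p) with <-≤-connex k (suc p)
  ... | inj₁ k<p = inj₁ (inj₂ k<p)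
  ... | inj₂ p≤k = inj₂ (s≤s z≤n , p≤k)

  -- The node blk s + p is a child of `p` beyond the code of `y`. Hence `y` is constant on its cone,
  -- with the value at `p`, so the cone lies below `y`; it misses `p` itself, so it is proper.
  split : ∀ y s p → y ≤ s → p ≤ s → 0 < s → p ≡ 0 ⊎ k < p → al (blk s + p) p ≡ true → ev y p ≡ true →
          Between algebra (cone (blk s + p)) y
  split y s p y≤s p≤s 0<s inner a yp =
    ev⇒below (par-induction _ at-zero inside) , ev⇒≢bot m (cone-self m) ,
    λ e → true≢false (subst (λ z → ev z p ≡ true) (sym e) yp) (cone-low p p<m)
    where
    m : ℕ
    m = blk s + p
    p<m : p < m
    p<m = +-monoˡ-≤ p (≤-trans 0<s (≤-blk s))
    y≤m : y ≤ m
    y≤m = ≤-trans y≤s (≤-trans (≤-blk s) (m≤m+n (blk s) p))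
    at-zero : ev (cone m) 0 ≡ true → ev y 0 ≡ true
    at-zero e = ⊥-elim (true≢false e (cone-low 0 (≤-<-trans z≤n p<m)))
    inside : ∀ q → (ev (cone m) (par (suc q)) ≡ true → ev y (par (suc q)) ≡ true) →
             ev (cone m) (suc q) ≡ true → ev y (suc q) ≡ true
    inside q ih e with <-cmp (suc q) m
    ... | tri< q<m _ _ = ⊥-elim (true≢false e (cone-low (suc q) q<m))
    ... | tri≈ _ eq _ = trans (cong (ev y) eq) (trans (ev-high y m y≤m (≤-<-trans z≤n p<m))
                            (trans (cong (ev y) (par-blk s p p≤s 0<s inner a)) yp))
    ... | tri> _ _ m<q = trans (ev-high y (suc q) (≤-trans y≤m (<⇒≤ m<q)) (s≤s z≤n))
                           (ih (trans (sym (cone-high (suc q) m<q)) e))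

  module Eventually (al-ev : ∀ p → ∃ λ s → ∀ m → s ≤ m → al m p ≡ true) where

    offLeaves-atomless : ∀ w → (∀ p → Leaf p → ev w p ≡ false) → Atomless algebra w
    offLeaves-atomless w off x x≤w x≢⊥ with inhabited x≢⊥
    ... | p , p≤x , xp with inner⊎leaf p | al-ev p
    ... | inj₂ isLeaf | _ = ⊥-elim (true≢false (below⇒ev x≤w p xp) (off p isLeaf))
    ... | inj₁ inner | s , always = _ ,
          split x t p (≤-trans (m≤m+n x s) (n≤1+n _)) (≤-trans p≤x (≤-trans (m≤m+n x s) (n≤1+n _))) (s≤s z≤n) inner
            (always _ (≤-trans (≤-trans (m≤n+m s x) (n≤1+n _)) (≤-trans (≤-blk t) (m≤m+n (blk t) p)))) xp
      where
      t : ℕ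
      -- Large enough to be beyond `x`, hence beyond `p`, and to come after the stage from which `p`
      -- admits children.
      t = suc (x + s)

    -- The leaves 1 to `k` are removed one by one. The root is never removed, which keeps the
    -- remainder nonzero.
    rank : AtomicRank algebra (top algebra) k
    rank = go 0 k refl (top algebra) (λ p 0<p p≤0 → ⊥-elim (<⇒≱ 0<p p≤0)) (λ p _ → ev-top p)
      where
      go : ∀ j d → j + d ≡ k → ∀ w → (∀ p → 0 < p → p ≤ j → ev w p ≡ false) → (∀ p → p ≡ 0 ⊎ j < p → ev w p ≡ true) →
           AtomicRank algebra w d
      go j zero e w off on = atomless (ev⇒≢bot 0 (on 0 (inj₁ refl)))
        (offLeaves-atomless w λ p (0<p , p≤k) → off p 0<p (≤-trans p≤k (≤-reflexive (trans (sym e) (+-identityʳ j)))))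
      go j (suc d) e w off on = splitAtom a
        (singleton-atom (suc j) (trans (ev-meet w a (suc j)) (cong₂ _∧_ (on (suc j) (inj₂ ≤-refl)) (cone-self (suc j))))
          λ q wq → cone-leaf isLeaf q (proj₂ (∧-true (ev w q) _ (trans (sym (ev-meet w a q)) wq))))
        (go (suc j) d (trans (sym (+-suc j d)) e) _ off′ on′)
        where
        a : ℕ
        a = cone (suc j)
        isLeaf : Leaf (suc j)
        isLeaf = s≤s z≤n , ≤-trans (m≤m+n (suc j) d) (≤-reflexive (trans (sym (+-suc j d)) e))
        ev-diff : ∀ p → ev (meet algebra w (compl algebra a)) p ≡ ev w p ∧ not (ev a p)
        ev-diff p = trans (ev-meet w _ p) (cong (ev w p ∧_) (ev-compl a p))
        off′ : ∀ p → 0 < p → p ≤ suc j → ev (meet algebra w (compl algebra a)) p ≡ false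
        off′ p 0<p p≤1+j with m≤n⇒m<n∨m≡n p≤1+j
        ... | inj₁ p≤j = trans (ev-diff p) (cong (_∧ not (ev a p)) (off p 0<p (s≤s⁻¹ p≤j)))
        ... | inj₂ refl = trans (ev-diff p) (trans (cong (λ b → ev w p ∧ not b) (cone-self p)) (∧-zeroʳ (ev w p)))
          where open import Data.Bool.Properties using (∧-zeroʳ)
        on′ : ∀ p → p ≡ 0 ⊎ suc j < p → ev (meet algebra w (compl algebra a)) p ≡ true
        on′ p h = trans (ev-diff p) (cong₂ (λ b c → b ∧ not c) (on p (relax h)) (outside (bool-split (ev a p)) h))
          where
          relax : p ≡ 0 ⊎ suc j < p → p ≡ 0 ⊎ j < p
          relax (inj₁ z) = inj₁ z
          relax (inj₂ lt) = inj₂ (<⇒≤ lt)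
          outside : ev a p ≡ true ⊎ ev a p ≡ false → p ≡ 0 ⊎ suc j < p → ev a p ≡ false
          outside (inj₂ f) _ = f
          outside (inj₁ t) h with cone-leaf isLeaf p t | h
          ... | refl | inj₂ lt = ⊥-elim (<-irrefl refl lt)

    inner-cone-atomless : ∀ p → k < p → Atomless algebra (cone p)
    inner-cone-atomless p k<p = offLeaves-atomless (cone p) λ q (_ , q≤k) → cone-low q (≤-<-trans q≤k k<p)

  module Immediate (al-true : ∀ m p → al m p ≡ true) where

    -- A node of `y` with index at most `y` cannot be a leaf, since its cone would be an atom below
    -- `y`; so it has a child in the very next block, whose cone splits `y`.
    quickSplit : ∀ y → y ≢ bot algebra → Atomless algebra y →
                 ∃ λ p → p ≤ y × Between algebra (cone (blk (suc y) + p)) y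
    quickSplit y y≢⊥ y-atomless with inhabited y≢⊥
    ... | p , p≤y , yp with inner⊎leaf p
    ... | inj₁ inner = p , p≤y , split y (suc y) p (n≤1+n y) (≤-trans p≤y (n≤1+n y)) (s≤s z≤n) inner (al-true _ p) yp
    ... | inj₂ isLeaf with y-atomless (cone p) (ev⇒below λ q pq → subst (λ q → ev y q ≡ true) (sym (cone-leaf isLeaf q pq)) yp)
                          (ev⇒≢bot p (cone-self p))
    ... | z , z≤p , z≢⊥ , z≢p with proj₂ (singleton-atom p (cone-self p) (cone-leaf isLeaf)) z z≤p
    ... | inj₁ e = ⊥-elim (z≢⊥ e)
    ... | inj₂ e = ⊥-elim (z≢p e)

  -- If `p` admits no node up to `x`, then no proper descendant of `p` has index up to `x`. Beyond
  -- `x` the map copies parents, so it is constant on the cone of `p` and cannot split it.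
  slowSplit : ∀ {p x} → k < p → Between algebra x (cone p) → ∃ λ m → m ≤ x × al m p ≡ true
  slowSplit {p} {x} k<p (x≤p , x≢⊥ , x≢p) with anyUpTo? (λ m → al m p ≟ᵇ true) (suc x)
  ... | yes (m , m<1+x , a) = m , s≤s⁻¹ m<1+x , a
  ... | no none = ⊥-elim (settle (bool-split (ev x p)))
    where
    child : ∀ q → p < q → ev (cone p) q ≡ true → ∃ λ m → m ≤ q × al m p ≡ true
    child = par-induction _ (λ ()) step
      where
      step : ∀ q → (p < par (suc q) → ev (cone p) (par (suc q)) ≡ true → ∃ λ m → m ≤ par (suc q) × al m p ≡ true) →
             p < suc q → ev (cone p) (suc q) ≡ true → ∃ λ m → m ≤ suc q × al m p ≡ true
      step q ih p<q e with <-cmp (par (suc q)) p | trans (sym (cone-high (suc q) p<q)) e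
      ... | tri< lt _ _ | e′ = ⊥-elim (true≢false e′ (cone-low _ lt))
      ... | tri≈ _ eq _ | _ = suc q , ≤-refl , proj₂ (proj₂ (par-pos (suc q) (≤-<-trans z≤n k<p) eq))
      ... | tri> _ _ gt | e′ with ih gt e′
      ... | m , m≤ , a = m , ≤-trans m≤ (<⇒≤ (par-< q)) , a

    constant : ∀ q → ev (cone p) q ≡ true → ev x q ≡ ev x p
    constant = par-induction _ (λ e → ⊥-elim (true≢false e (cone-low 0 (≤-<-trans z≤n k<p)))) step
      where
      step : ∀ q → (ev (cone p) (par (suc q)) ≡ true → ev x (par (suc q)) ≡ ev x p) →
             ev (cone p) (suc q) ≡ true → ev x (suc q) ≡ ev x p
      step q ih e with <-cmp (suc q) p
      ... | tri< lt _ _ = ⊥-elim (true≢false e (cone-low _ lt))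
      ... | tri≈ _ eq _ = cong (ev x) eq
      ... | tri> _ _ gt with <-≤-connex x (suc q)
      ... | inj₁ x<q = trans (ev-high x (suc q) (<⇒≤ x<q) (s≤s z≤n)) (ih (trans (sym (cone-high (suc q) gt)) e))
      ... | inj₂ q≤x with child (suc q) gt e
      ... | m , m≤q , a = ⊥-elim (none (m , s≤s (≤-trans m≤q q≤x) , a))

    settle : ev x p ≡ true ⊎ ev x p ≡ false → ⊥
    settle (inj₁ xp) = x≢p (ev-ext λ m → bool-ext _ _ (below⇒ev x≤p m) λ pm → trans (constant m pm) xp)
    settle (inj₂ xp) = x≢⊥ (ev-ext λ m → bool-ext _ _
      (λ xm → ⊥-elim (true≢false xm (trans (constant m (below⇒ev x≤p m xm)) xp)))
      λ bm → ⊥-elim (true≢false bm (ev-bot m)))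

-- Primitive recursiveness of the tree algebras

module HelperPrimRec {O : Sig} (σ : Interp O) where
  open PrimRec σ

  halfR : ∀ {n} {a : Vec ℕ n → ℕ} → Rec a → Rec (λ xs → half (a xs))
  halfR ra = natrecR zeroR (+R (oddR x₁) x₀) ra

  bitR : ∀ {n} {m x : Vec ℕ n → ℕ} → Rec m → Rec x → Recᵇ (λ xs → bit (m xs) (x xs))
  bitR rm rx = oddR (natrecR rx (halfR x₀) rm)

  pow2R : ∀ {n} {a : Vec ℕ n → ℕ} → Rec a → Rec (λ xs → pow2 (a xs))
  pow2R ra = natrecR (constR 1) (+R x₀ x₀) ra

  blkR : ∀ {n} {a : Vec ℕ n → ℕ} → Rec a → Rec (λ xs → blk (a xs))
  blkR ra = natrecR zeroR (sucR (+R x₀ x₀)) ra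

  sameR : ∀ {n} {a b : Vec ℕ n → ℕ} → Rec a → Rec b → Recᵇ (λ xs → same (a xs) (b xs))
  sameR ra rb = boolR (λ c _ → not c) (posR (+R (∸R ra rb) (∸R rb ra))) (constᵇR true)

  decR : ∀ {n} {a : Vec ℕ n → ℕ} → Rec a → Rec (λ xs → dec (a xs))
  decR ra = ∸R ra (natrecR zeroR (ifR (sameR x₁ (+R x₀ x₀)) (sucR x₁) x₀) ra)

  module _ (k : ℕ) (al : ℕ → ℕ → Bool) (alR : Recᵇ {2} (λ v → al (lookup v zero) (lookup v (suc zero)))) where
    open TreeAlgebra k al

    parR : ∀ {n} {a : Vec ℕ n → ℕ} → Rec a → Rec (λ xs → par (a xs))
    parR ra = ifR (boolR _∧_ (boolR _∧_ (posR (∸R ra d)) (posR (∸R d (constR k)))) (app alR (ra ∷R d ∷R []R))) d zeroR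
      where d = decR ra

    markR : ∀ {n} {x m : Vec ℕ n → ℕ} → Rec x → Rec m → Rec (λ xs → mark (x xs) (m xs))
    markR rx rm = ifR (posR rm) (bitR rm rx) zeroR

    opaque
      unfolding ev
      evR : ∀ {n} {x m : Vec ℕ n → ℕ} → Rec x → Rec m → Recᵇ (λ xs → ev (x xs) (m xs))
      evR rx rm = oddR (+R (bitR zeroR rx)
        (natrecR zeroR (+R (markR (weaken 2 rx) (natrecR (weaken 2 rm) (parR x₀) x₁)) x₀) rm))

    digitR : ∀ {n} (β : Bool → Bool → Bool) {x y m : Vec ℕ n → ℕ} → Rec x → Rec y → Rec m →
             Recᵇ (λ xs → digit β (x xs) (y xs) (m xs))
    digitR β rx ry rm = boolR _xor_ (boolR β (evR rx rm) (evR ry rm))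
      (boolR _∧_ (posR rm) (boolR β (evR rx (parR rm)) (evR ry (parR rm))))

    opaque
      unfolding op
      opR : ∀ {n} (β : Bool → Bool → Bool) {x y : Vec ℕ n → ℕ} → Rec x → Rec y → Rec (λ xs → op β (x xs) (y xs))
      opR β rx ry = natrecR zeroR
        (+R (digitR β (weaken 2 rx) (weaken 2 ry) (∸R (weaken 2 (sucR (+R rx ry))) (sucR x₁))) (+R x₀ x₀))
        (sucR (+R rx ry))

algebra-punctual : ∀ k al → PrimRec.Recᵇ noOrc {2} (λ v → al (lookup v zero) (lookup v (suc zero))) →
                   Punctual (TreeAlgebra.algebra k al)
algebra-punctual k al alR = binary-op _∨_ , binary-op _∧_ ,
  let r = opR k al alR (λ a _ → not a) {λ v → lookup v zero} x₀ x₀ in proj₁ r , λ x → proj₂ r (x ∷ [])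
  where
  open PrimRec noOrc
  open HelperPrimRec noOrc
  binary-op : ∀ β → PrimRec₂ (TreeAlgebra.op k al β)
  binary-op β = let r = opR k al alR β {λ v → lookup v zero} {λ v → lookup v (suc zero)} x₀ x₁ in
    proj₁ r , λ x y → proj₂ r (x ∷ y ∷ [])

-- Relative computability

mutual
  embed : ∀ {O n} → PR O n → MuR O n
  embed zer = zer
  embed succ = succ
  embed (proj i) = proj i
  embed (comp f gs) = comp (embed f) (embeds gs)
  embed (prec g h) = prec (embed g) (embed h)
  embed (orc o) = orc o

  embeds : ∀ {O m n} → Vec (PR O n) m → Vec (MuR O n) m
  embeds [] = []
  embeds (g ∷ gs) = embed g ∷ embeds gs

module _ {O : Sig} (σ : Interp O) where
  mutual
    embed-sound : ∀ {n} (t : PR O n) xs → _⇓_ σ (embed t , xs) (evalPR σ t xs)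
    embed-sound zer xs = ev-zer
    embed-sound succ (x ∷ []) = ev-succ
    embed-sound (proj i) xs = ev-proj
    embed-sound (comp f gs) xs = ev-comp (embeds-sound gs xs) (embed-sound f _)
    embed-sound (prec g h) (zero ∷ xs) = ev-prec0 (embed-sound g xs)
    embed-sound (prec g h) (suc x ∷ xs) = ev-precS (embed-sound (prec g h) (x ∷ xs)) (embed-sound h _)
    embed-sound (orc o) xs = ev-orc

    embeds-sound : ∀ {m n} (gs : Vec (PR O n) m) xs → _⇓s_ σ (embeds gs , xs) (evalPRs σ gs xs)
    embeds-sound [] xs = evs-[]
    embeds-sound (g ∷ gs) xs = evs-∷ (embed-sound g xs) (embeds-sound gs xs)

module _ {O O′ : Sig} (τ : ∀ {n} → O n → MuR O′ n) where
  mutual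
    inline : ∀ {n} → MuR O n → MuR O′ n
    inline zer = zer
    inline succ = succ
    inline (proj i) = proj i
    inline (comp f gs) = comp (inline f) (inlines gs)
    inline (prec g h) = prec (inline g) (inline h)
    inline (mu f) = mu (inline f)
    inline (orc o) = τ o

    inlines : ∀ {m n} → Vec (MuR O n) m → Vec (MuR O′ n) m
    inlines [] = []
    inlines (g ∷ gs) = inline g ∷ inlines gs

  module _ (σ : Interp O) (σ′ : Interp O′) (τ-sound : ∀ {n} (o : O n) xs → _⇓_ σ′ (τ o , xs) (σ o xs)) where
    mutual
      inline-sound : ∀ {n} {t : MuR O n} {xs y} → _⇓_ σ (t , xs) y → _⇓_ σ′ (inline t , xs) y
      inline-sound ev-zer = ev-zer
      inline-sound ev-succ = ev-succ
      inline-sound ev-proj = ev-proj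
      inline-sound (ev-comp ds d) = ev-comp (inlines-sound ds) (inline-sound d)
      inline-sound (ev-prec0 d) = ev-prec0 (inline-sound d)
      inline-sound (ev-precS d d′) = ev-precS (inline-sound d) (inline-sound d′)
      inline-sound {t = mu f} {xs} {y} (ev-mu d ds) = ev-mu (inline-sound d) below
        where
        below : ∀ z → z < y → ∃ λ k → _⇓_ σ′ (inline f , z ∷ xs) (suc k)
        below z z<y with ds z z<y
        ... | k , d′ = k , inline-sound d′
      inline-sound {t = orc o} {xs} ev-orc = τ-sound o xs

      inlines-sound : ∀ {m n} {gs : Vec (MuR O n) m} {xs ys} → _⇓s_ σ (gs , xs) ys → _⇓s_ σ′ (inlines gs , xs) ys
      inlines-sound evs-[] = evs-[]
      inlines-sound (evs-∷ d ds) = evs-∷ (inline-sound d) (inlines-sound ds)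

punctual-computable : ∀ {C f} → Punctual C → ComputableRel (diag C) f → Computable f
punctual-computable {C} ((tj , pj) , (tm , pm) , (tc , pc)) (t , p) =
  inline prog t , λ x → inline-sound prog (diag C) noOrc prog-sound (p x)
  where
  open PrimRec noOrc
  prog : ∀ {n} → BASym n → MuR NoOrc n
  prog s-join = embed tj
  prog s-meet = embed tm
  prog s-compl = embed tc
  prog s-top = embed (proj₁ (constR (top C)))
  prog s-bot = embed (proj₁ (constR (bot C)))
  prog-sound : ∀ {n} (o : BASym n) xs → _⇓_ noOrc (prog o , xs) (diag C o xs)
  prog-sound s-join (x ∷ y ∷ []) = subst (_⇓_ noOrc _) (pj x y) (embed-sound noOrc tj _)
  prog-sound s-meet (x ∷ y ∷ []) = subst (_⇓_ noOrc _) (pm x y) (embed-sound noOrc tm _)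
  prog-sound s-compl (x ∷ []) = subst (_⇓_ noOrc _) (pc x) (embed-sound noOrc tc _)
  prog-sound s-top [] = subst (_⇓_ noOrc _) (proj₂ (constR (top C)) []) (embed-sound noOrc _ _)
  prog-sound s-bot [] = subst (_⇓_ noOrc _) (proj₂ (constR (bot C)) []) (embed-sound noOrc _ _)

inverse-computable : ∀ {f g} → (∀ x → g (f x) ≡ x) → (∀ y → f (g y) ≡ y) → Computable f → Computable g
inverse-computable {f} {g} gf fg (t , p) = mu test , λ x →
  ev-mu (subst (_⇓_ noOrc _) (hit x) (test-sound (g x) x)) λ z z<gx → miss x z z<gx
  where
  open PrimRec noOrc
  dist : ℕ → ℕ → ℕ
  dist a b = (a ∸ b) + (b ∸ a)
  distR : Rec {2} (λ v → dist (lookup v zero) (lookup v (suc zero)))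
  distR = +R (∸R x₀ x₁) (∸R x₁ x₀)
  test : MuR NoOrc 2
  test = comp (embed (proj₁ distR)) (comp t (proj zero ∷ []) ∷ proj (suc zero) ∷ [])
  test-sound : ∀ z x → _⇓_ noOrc (test , z ∷ x ∷ []) (dist (f z) x)
  test-sound z x = ev-comp (evs-∷ (ev-comp (evs-∷ ev-proj evs-[]) (p z)) (evs-∷ ev-proj evs-[]))
    (subst (_⇓_ noOrc _) (proj₂ distR (f z ∷ x ∷ [])) (embed-sound noOrc (proj₁ distR) _))
  hit : ∀ x → dist (f (g x)) x ≡ 0
  hit x rewrite fg x | n∸n≡0 x = refl
  miss : ∀ x z → z < g x → ∃ λ k → _⇓_ noOrc (test , z ∷ x ∷ []) (suc k)
  miss x z z<gx with dist (f z) x in e | test-sound z x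
  ... | suc k | d = k , d
  ... | zero | _ = ⊥-elim (<-irrefl (trans (sym (gf z)) (cong g (≤-antisym
          (m∸n≡0⇒m≤n (m+n≡0⇒m≡0 (f z ∸ x) e)) (m∸n≡0⇒m≤n (m+n≡0⇒n≡0 (f z ∸ x) e))))) z<gx)

IsIso-sym : ∀ {A C f g} → IsIso A C f g → IsIso C A g f
IsIso-sym {A} {C} {f} {g} iso = record
  { left = right ; right = left
  ; pres-join = λ x y → back (trans (cong₂ (join C) (sym (right x)) (sym (right y))) (sym (pres-join (g x) (g y))))
  ; pres-meet = λ x y → back (trans (cong₂ (meet C) (sym (right x)) (sym (right y))) (sym (pres-meet (g x) (g y))))
  ; pres-compl = λ x → back (trans (cong (compl C) (sym (right x))) (sym (pres-compl (g x))))
  ; pres-top = back (sym pres-top)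
  ; pres-bot = back (sym pres-bot)
  }
  where
  open IsIso iso
  back : ∀ {x y} → y ≡ f x → g y ≡ x
  back {x} e = trans (cong g e) (left x)

cone⇒prCat : ∀ {B d} → RelCompCat B → InCone d → InPrCat B d
cone⇒prCat rcc cone C punctual C≅B with rcc C C≅B
... | f , g , iso , comp-f = g , f , IsIso-sym iso , cone g (inverse-computable left right f-comp) , cone f f-comp
  where
  open IsIso iso
  f-comp : Computable f
  f-comp = punctual-computable {C} punctual comp-f

-- Isomorphisms bound running times

IsIso-trans : ∀ {A C D f g f′ g′} → IsIso A C f g → IsIso C D f′ g′ → IsIso A D (f′ ∘ f) (g ∘ g′)
IsIso-trans {f = f} {g} {f′} {g′} i j = record
  { left = λ x → trans (cong g (J.left (f x))) (I.left x)
  ; right = λ y → trans (cong f′ (I.right (g′ y))) (J.right y)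
  ; pres-join = λ x y → trans (cong f′ (I.pres-join x y)) (J.pres-join _ _)
  ; pres-meet = λ x y → trans (cong f′ (I.pres-meet x y)) (J.pres-meet _ _)
  ; pres-compl = λ x → trans (cong f′ (I.pres-compl x)) (J.pres-compl _)
  ; pres-top = trans (cong f′ I.pres-top) J.pres-top
  ; pres-bot = trans (cong f′ I.pres-bot) J.pres-bot
  }
  where
  module I = IsIso i
  module J = IsIso j

module Transfer {A C : Str} {f g : ℕ → ℕ} (iso : IsIso A C f g) where
  open IsIso iso
  module Inv = IsIso (IsIso-sym iso)

  injective : ∀ {x y} → f x ≡ f y → x ≡ y
  injective {x} {y} e = trans (sym (left x)) (trans (cong g e) (left y))

  below : ∀ {x y} → Below A x y → Below C (f x) (f y)
  below {x} {y} e = trans (sym (pres-meet x y)) (cong f e)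

  below⁻ : ∀ {x w} → Below C x (f w) → Below A (g x) w
  below⁻ {x} {w} e = trans (cong (meet A (g x)) (sym (left w))) (trans (sym (Inv.pres-meet x (f w))) (cong g e))

  ≢bot : ∀ {x} → x ≢ bot A → f x ≢ bot C
  ≢bot x≢⊥ e = x≢⊥ (injective (trans e (sym pres-bot)))

  ≢bot⁻ : ∀ {x} → x ≢ bot C → g x ≢ bot A
  ≢bot⁻ {x} x≢⊥ e = x≢⊥ (trans (sym (right x)) (trans (cong f e) pres-bot))

  between : ∀ {z x} → Between A z x → Between C (f z) (f x)
  between (z≤x , z≢⊥ , z≢x) = below z≤x , ≢bot z≢⊥ , z≢x ∘ injective

  atomless-image : ∀ {w} → Atomless A w → Atomless C (f w)
  atomless-image h x x≤ x≢⊥ with h (g x) (below⁻ x≤) (≢bot⁻ x≢⊥)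
  ... | z , b = f z , subst (Between C (f z)) (right x) (between b)

  atom-image : ∀ {a} → Atom A a → Atom C (f a)
  atom-image {a} (a≢⊥ , h) = ≢bot a≢⊥ , λ x x≤ → settle x (h (g x) (below⁻ x≤))
    where
    settle : ∀ x → g x ≡ bot A ⊎ g x ≡ a → x ≡ bot C ⊎ x ≡ f a
    settle x (inj₁ e) = inj₁ (trans (sym (right x)) (trans (cong f e) pres-bot))
    settle x (inj₂ e) = inj₂ (trans (sym (right x)) (cong f e))

sumBelow : (ℕ → ℕ) → ℕ → ℕ
sumBelow f = natrec 0 (λ i r → f i + r)

≤-sumBelow : ∀ f {i} n → i < n → f i ≤ sumBelow f n
≤-sumBelow f {i} (suc n) i<1+n with m≤n⇒m<n∨m≡n (s≤s⁻¹ i<1+n)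
... | inj₁ i<n = ≤-trans (≤-sumBelow f n i<n) (m≤n+m _ (f n))
... | inj₂ refl = m≤m+n (f i) _

-- An isomorphism from the algebra whose node 1 + k + n gets its first child only after the
-- computation of f n has stopped, onto the algebra where every node is split at once, bounds the
-- running time of that computation.
module Delay (k : ℕ) (t : MuR NoOrc 1) (f : ℕ → ℕ) (t-computes : ∀ n → _⇓_ noOrc (t , n ∷ []) (f n)) where

  -- Node suc k + n watches the computation of f n. Truncation sends the nodes up to `k` to n = 0,
  -- harmlessly: `par` takes as parent only 0 or a node beyond `k`.
  stopped : ℕ → ℕ → Bool
  stopped m p = pos (run t m (p ∸ suc k ∷ []))

  module Slow = TreeAlgebra k stopped
  module Quick = TreeAlgebra k (λ _ _ → true)

  stopped-eventually : ∀ p → ∃ λ s → ∀ m → s ≤ m → stopped m p ≡ true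
  stopped-eventually p with run-complete (t-computes (p ∸ suc k))
  ... | s , e = s , λ m s≤m → cong pos (run-mono t _ s≤m e)

  module SlowEv = Slow.Eventually stopped-eventually
  module QuickEv = Quick.Eventually (λ _ → 0 , λ _ _ → refl)

  slow-punctual : Punctual Slow.algebra
  slow-punctual = algebra-punctual k stopped
    (cast (λ { (m ∷ p ∷ []) → refl }) (posR (app (runR t) (x₀ ∷R ∸R x₁ (constR (suc k)) ∷R []R))))
    where
    open PrimRec noOrc
    open RunPrimRec noOrc

  quick-punctual : Punctual Quick.algebra
  quick-punctual = algebra-punctual k _ (PrimRec.constᵇR noOrc true)

  run-value : ∀ {m n} → pos (run t m (n ∷ [])) ≡ true → run t m (n ∷ []) ≡ suc (f n)
  run-value {m} {n} e with run t m (n ∷ []) in r | run-complete (t-computes n)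
  ... | suc y | s , c = trans (sym (run-mono t _ (m≤m+n m s) r)) (run-mono t _ (m≤n+m s m) c)

  module _ {F G : ℕ → ℕ} (iso : IsIso Slow.algebra Quick.algebra F G) where
    module To = Transfer iso
    module From = Transfer (IsIso-sym iso)

    -- `quickSplit` yields a split among the candidates with i ≤ y without computing i; summing the
    -- preimages of all of them dominates the preimage of the right one.
    fuel : ℕ → ℕ
    fuel n = sumBelow (λ i → G (pow2 (blk (suc y) + i))) (suc y)
      where y = F (pow2 (suc k + n))

    fuel-suffices : ∀ n → run t (fuel n) (n ∷ []) ≡ suc (f n)
    fuel-suffices n with Quick.Immediate.quickSplit (λ _ _ → refl) (F (pow2 p))
        (To.≢bot (Slow.ev⇒≢bot p (Slow.cone-self p))) (To.atomless-image (SlowEv.inner-cone-atomless p k<p))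
      where
      p : ℕ
      p = suc k + n
      k<p : k < p
      k<p = m≤m+n (suc k) n
    ... | i , i≤y , b with Slow.slowSplit (m≤m+n (suc k) n)
                             (subst (Between Slow.algebra _) (IsIso.left iso _) (From.between b))
    ... | m , m≤ , a = run-mono t (n ∷ []) (≤-trans m≤ (≤-sumBelow _ _ (s≤s i≤y)))
            (run-value (trans (cong (λ q → pos (run t m (q ∷ []))) (sym (m+n∸m≡n (suc k) n))) a))

    f-≤PR : ∀ {d} → F ≤PR d → G ≤PR d → f ≤PR d
    f-≤PR {d} (tF , pF) (tG , pG) = proj₁ whole , λ n → trans (proj₂ whole (n ∷ [])) (cong pred (fuel-suffices n))
      where
      open PrimRec (funOrc d)
      open HelperPrimRec (funOrc d)
      open RunPrimRec (funOrc d)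
      call : ∀ {h : ℕ → ℕ} → h ≤PR d → ∀ {n} {a : Vec ℕ n → ℕ} → Rec a → Rec (λ xs → h (a xs))
      call {h} (th , ph) ra = app {f = λ v → h (lookup v zero)} (th , λ { (x ∷ []) → ph x }) (ra ∷R []R)
      yR : Rec {1} (λ v → F (pow2 (suc k + lookup v zero)))
      yR = call (tF , pF) (pow2R (+R (constR (suc k)) x₀))
      whole : Rec {1} (λ v → pred (run t (fuel (lookup v zero)) (lookup v zero ∷ [])))
      whole = predR (app (runR t)
        (cast (λ { (n ∷ []) → refl }) (natrecR zeroR (+R (call (tG , pG) (pow2R (+R (blkR (sucR (weaken 2 yR))) x₁))) x₀) (sucR yR))
          ∷R x₀ ∷R []R))

≤PR-∘ : ∀ {f g d} → f ≤PR d → g ≤PR d → (f ∘ g) ≤PR d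
≤PR-∘ {f} {g} (tf , pf) (tg , pg) =
  comp tf (tg ∷ []) , λ x → trans (cong (λ z → evalPR _ tf (z ∷ [])) (pg x)) (pf (g x))

-- The comparison map runs from the slow copy through B to the quick one. Each direction composes an
-- isomorphism with an inverse, so the bounds on both are used.
prCat⇒cone : ∀ {B k d} → IsBA B → AtomicRank B (top B) k → InPrCat B d → InCone d
prCat⇒cone {B} {k} {d} isB rank cat f (t , p) = combine
  (cat Slow.algebra slow-punctual (sameRank⇒≅ Slow.isBooleanAlgebra isB SlowEv.rank rank))
  (cat Quick.algebra quick-punctual (sameRank⇒≅ Quick.isBooleanAlgebra isB QuickEv.rank rank))
  where
  open Delay k t f p
  Copy : Str → Set
  Copy C = Σ (ℕ → ℕ) λ f → Σ (ℕ → ℕ) λ g → IsIso B C f g × f ≤PR d × g ≤PR d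
  combine : Copy Slow.algebra → Copy Quick.algebra → f ≤PR d
  combine (f₁ , g₁ , i₁ , f₁≤ , g₁≤) (f₂ , g₂ , i₂ , f₂≤ , g₂≤) =
    f-≤PR {f₂ ∘ g₁} {f₁ ∘ g₂} (IsIso-trans (IsIso-sym i₁) i₂) (≤PR-∘ {f₂} {g₁} f₂≤ g₁≤) (≤PR-∘ {f₁} {g₂} f₁≤ g₂≤)

-- Finite use and copies along permutations

module _ {O : Sig} (σ : Interp O) where
  mutual
    deterministic : ∀ {n} {t : MuR O n} {xs y y′} → _⇓_ σ (t , xs) y → _⇓_ σ (t , xs) y′ → y ≡ y′
    deterministic ev-zer ev-zer = refl
    deterministic ev-succ ev-succ = refl
    deterministic ev-proj ev-proj = refl
    deterministic (ev-comp ds d) (ev-comp ds′ d′) with deterministics ds ds′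
    ... | refl = deterministic d d′
    deterministic (ev-prec0 d) (ev-prec0 d′) = deterministic d d′
    deterministic (ev-precS d e) (ev-precS d′ e′) with deterministic d d′
    ... | refl = deterministic e e′
    deterministic {y = y} {y′} (ev-mu d h) (ev-mu d′ h′) with <-cmp y y′
    ... | tri≈ _ e _ = e
    ... | tri< y<y′ _ _ with h′ y y<y′
    ... | k , d″ with deterministic d d″
    ... | ()
    deterministic {y = y} {y′} (ev-mu d h) (ev-mu d′ h′) | tri> _ _ y′<y with h y′ y′<y
    ... | k , d″ with deterministic d″ d′
    ... | ()
    deterministic ev-orc ev-orc = refl

    deterministics : ∀ {m n} {gs : Vec (MuR O n) m} {xs ys ys′} → _⇓s_ σ (gs , xs) ys → _⇓s_ σ (gs , xs) ys′ → ys ≡ ys′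
    deterministics evs-[] evs-[] = refl
    deterministics (evs-∷ d ds) (evs-∷ d′ ds′) = cong₂ _∷_ (deterministic d d′) (deterministics ds ds′)

-- Values are restricted along with arguments: an element whose code is not below N has not been
-- fixed yet, and another copy may code it differently.
Agree : ∀ {O} → ℕ → Interp O → Interp O → Set
Agree {O} N σ σ′ = ∀ {n} (o : O n) xs → (∀ i → lookup xs i < N) → σ o xs < N → σ′ o xs ≡ σ o xs

Agree-mono : ∀ {O N N′} (σ σ′ : Interp O) → N ≤ N′ → Agree N′ σ σ′ → Agree N σ σ′
Agree-mono σ σ′ le ag o xs low val = ag o xs (λ i → ≤-trans (low i) le) (≤-trans val le)

lookup≤sum : ∀ {n} (xs : Vec ℕ n) i → lookup xs i ≤ Data.Vec.sum xs
lookup≤sum (x ∷ xs) zero = m≤m+n x _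
lookup≤sum (x ∷ xs) (suc i) = ≤-trans (lookup≤sum xs i) (m≤n+m _ x)

module _ {O : Sig} (σ : Interp O) where
  mutual
    use : ∀ {n} {t : MuR O n} {xs y} → _⇓_ σ (t , xs) y →
          ∃ λ N → ∀ (σ′ : Interp O) → Agree N σ σ′ → _⇓_ σ′ (t , xs) y
    use ev-zer = 0 , λ _ _ → ev-zer
    use ev-succ = 0 , λ _ _ → ev-succ
    use ev-proj = 0 , λ _ _ → ev-proj
    use (ev-comp ds d) with uses ds | use d
    ... | N , u | N′ , u′ = N + N′ , λ σ′ ag →
          ev-comp (u σ′ (Agree-mono σ σ′ (m≤m+n N N′) ag)) (u′ σ′ (Agree-mono σ σ′ (m≤n+m N′ N) ag))
    use (ev-prec0 d) with use d
    ... | N , u = N , λ σ′ ag → ev-prec0 (u σ′ ag)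
    use (ev-precS d d′) with use d | use d′
    ... | N , u | N′ , u′ = N + N′ , λ σ′ ag →
          ev-precS (u σ′ (Agree-mono σ σ′ (m≤m+n N N′) ag)) (u′ σ′ (Agree-mono σ σ′ (m≤n+m N′ N) ag))
    use {t = mu f} {xs} {y} (ev-mu d ds) with use d
      | uniform {λ z N → ∃ λ k → ∀ (σ′ : Interp O) → Agree N σ σ′ → _⇓_ σ′ (f , z ∷ xs) (suc k)}
          (λ z le (k , u) → k , λ σ′ ag → u σ′ (Agree-mono σ σ′ le ag)) y (λ z z<y → below z z<y)
      where
      below : ∀ z → z < y → ∃ λ N → ∃ λ k → ∀ (σ′ : Interp O) → Agree N σ σ′ → _⇓_ σ′ (f , z ∷ xs) (suc k)
      below z z<y with ds z z<y
      ... | k , d′ with use d′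
      ... | N , u = N , k , u
    ... | N , u | N′ , h = N + N′ , λ σ′ ag →
          ev-mu (u σ′ (Agree-mono σ σ′ (m≤m+n N N′) ag))
            λ z z<y → proj₁ (h z z<y) , proj₂ (h z z<y) σ′ (Agree-mono σ σ′ (m≤n+m N′ N) ag)
    use {t = orc o} {xs} ev-orc = suc (Data.Vec.sum xs + σ o xs) , λ σ′ ag →
      subst (_⇓_ σ′ (orc o , xs))
        (ag o xs (λ i → s≤s (≤-trans (lookup≤sum xs i) (m≤m+n _ _))) (s≤s (m≤n+m _ (Data.Vec.sum xs))))
        ev-orc

    uses : ∀ {m n} {gs : Vec (MuR O n) m} {xs ys} → _⇓s_ σ (gs , xs) ys →
           ∃ λ N → ∀ (σ′ : Interp O) → Agree N σ σ′ → _⇓s_ σ′ (gs , xs) ys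
    uses evs-[] = 0 , λ _ _ → evs-[]
    uses (evs-∷ d ds) with use d | uses ds
    ... | N , u | N′ , u′ = N + N′ , λ σ′ ag →
          evs-∷ (u σ′ (Agree-mono σ σ′ (m≤m+n N N′) ag)) (u′ σ′ (Agree-mono σ σ′ (m≤n+m N′ N) ag))

-- Finite lists that exhaust the programs

vectors : ∀ {A : Set} m → List A → List (Vec A m)
vectors zero as = [] ∷ []
vectors (suc m) as = cartesianProductWith _∷_ as (vectors m as)

symbols : ∀ n → List (BASym n)
symbols 0 = s-top ∷ s-bot ∷ []
symbols 1 = s-compl ∷ []
symbols 2 = s-join ∷ s-meet ∷ []
symbols (suc (suc (suc _))) = []

symbols-complete : ∀ {n} (o : BASym n) → o ∈ symbols n
symbols-complete s-join = here refl
symbols-complete s-meet = there (here refl)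
symbols-complete s-compl = here refl
symbols-complete s-top = here refl
symbols-complete s-bot = there (here refl)

successors : ∀ n → List (MuR BASym n)
successors 1 = succ ∷ []
successors _ = []

mutual
  -- The first argument bounds the nesting depth and also the intermediate arity of compositions;
  -- without the latter the lists would not be finite.
  programs : ℕ → ∀ n → List (MuR BASym n)
  programs zero n = []
  programs (suc d) n = zer ∷ successors n ++ map proj (allFin n) ++ map orc (symbols n) ++
                       compositions d n d ++ recursions d n ++ map mu (programs d (suc n))

  compositions : ℕ → ∀ n → ℕ → List (MuR BASym n)
  compositions d n zero = []
  compositions d n (suc m) = cartesianProductWith comp (programs d m) (vectors m (programs d n)) ++ compositions d n m

  recursions : ℕ → ∀ n → List (MuR BASym n)
  recursions d zero = []
  recursions d (suc n) = cartesianProductWith prec (programs d n) (programs d (2 + n))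

compositions-complete : ∀ d {n m} b {f : MuR BASym m} {gs : Vec (MuR BASym n) m} → m < b → f ∈ programs d m →
                        gs ∈ vectors m (programs d n) → comp f gs ∈ compositions d n b
compositions-complete d (suc b) m<1+b f∈ gs∈ with m≤n⇒m<n∨m≡n (s≤s⁻¹ m<1+b)
... | inj₁ m<b = ∈-++⁺ʳ _ (compositions-complete d b m<b f∈ gs∈)
... | inj₂ refl = ∈-++⁺ˡ (∈-cartesianProductWith⁺ comp f∈ gs∈)

mutual
  -- Membership is asserted for all late lists, so that the bounds of several subprograms can simply
  -- be added.
  listed : ∀ {n} (t : MuR BASym n) → ∃ λ d → ∀ e → d ≤ e → t ∈ programs e n
  listed zer = 1 , λ { (suc e) _ → here refl }
  listed succ = 1 , λ { (suc e) _ → there (here refl) }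
  listed {n} (proj i) = 1 , λ { (suc e) _ → there (∈-++⁺ʳ (successors n) (∈-++⁺ˡ (∈-map⁺ proj (∈-allFin i)))) }
  listed {n} (orc o) = 1 , λ { (suc e) _ → there (∈-++⁺ʳ (successors n) (∈-++⁺ʳ (map proj (allFin n))
    (∈-++⁺ˡ (∈-map⁺ orc (symbols-complete o))))) }
  listed {n} (comp {m} f gs) with listed f | listeds gs
  ... | d , p | d′ , q = suc (suc m + (d + d′)) , λ { (suc e) (s≤s le) →
    let le′ = ≤-trans (m≤n+m (d + d′) (suc m)) le in
    there (∈-++⁺ʳ (successors n) (∈-++⁺ʳ (map proj (allFin n)) (∈-++⁺ʳ (map orc (symbols n))
      (∈-++⁺ˡ (compositions-complete e e (≤-trans (m≤m+n (suc m) _) le)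
        (p e (≤-trans (m≤m+n d d′) le′)) (q e (≤-trans (m≤n+m d′ d) le′))))))) }
  listed {suc n} (prec g h) with listed g | listed h
  ... | d , p | d′ , q = suc (d + d′) , λ { (suc e) (s≤s le) →
    there (∈-++⁺ʳ (successors (suc n)) (∈-++⁺ʳ (map proj (allFin (suc n))) (∈-++⁺ʳ (map orc (symbols (suc n)))
      (∈-++⁺ʳ (compositions e (suc n) e) (∈-++⁺ˡ (∈-cartesianProductWith⁺ prec
        (p e (≤-trans (m≤m+n d d′) le)) (q e (≤-trans (m≤n+m d′ d) le)))))))) }
  listed {n} (mu f) with listed f
  ... | d , p = suc d , λ { (suc e) (s≤s le) →
    there (∈-++⁺ʳ (successors n) (∈-++⁺ʳ (map proj (allFin n)) (∈-++⁺ʳ (map orc (symbols n))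
      (∈-++⁺ʳ (compositions e n e) (∈-++⁺ʳ (recursions e n) (∈-map⁺ mu (p e le))))))) }

  listeds : ∀ {m n} (gs : Vec (MuR BASym n) m) → ∃ λ d → ∀ e → d ≤ e → gs ∈ vectors m (programs e n)
  listeds [] = 0 , λ _ _ → here refl
  listeds (g ∷ gs) with listed g | listeds gs
  ... | d , p | d′ , q = d + d′ , λ e le →
    ∈-cartesianProductWith⁺ _∷_ (p e (≤-trans (m≤m+n d d′) le)) (q e (≤-trans (m≤n+m d′ d) le))

-- Permutations and the copies they induce

record Perm : Set where
  field
    to from : ℕ → ℕ
    from-to : ∀ x → from (to x) ≡ x
    to-from : ∀ y → to (from y) ≡ y
open Perm

to-injective : ∀ (π : Perm) {x y} → to π x ≡ to π y → x ≡ y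
to-injective π {x} {y} e = trans (sym (from-to π x)) (trans (cong (from π) e) (from-to π y))

identity : Perm
identity = record { to = id ; from = id ; from-to = λ _ → refl ; to-from = λ _ → refl }

swap : ℕ → ℕ → ℕ → ℕ
swap a b z with z ≟ a | z ≟ b
... | yes _ | _ = b
... | no _ | yes _ = a
... | no _ | no _ = z

swap-first : ∀ a b → swap a b a ≡ b
swap-first a b with a ≟ a
... | yes _ = refl
... | no ¬e = ⊥-elim (¬e refl)

swap-second : ∀ a b → swap a b b ≡ a
swap-second a b with b ≟ a | b ≟ b
... | yes e | _ = e
... | no _ | yes _ = refl
... | no _ | no ¬e = ⊥-elim (¬e refl)

swap-other : ∀ a b {z} → z ≢ a → z ≢ b → swap a b z ≡ z
swap-other a b {z} z≢a z≢b with z ≟ a | z ≟ b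
... | yes e | _ = ⊥-elim (z≢a e)
... | no _ | yes e = ⊥-elim (z≢b e)
... | no _ | no _ = refl

swap-involutive : ∀ a b z → swap a b (swap a b z) ≡ z
swap-involutive a b z = go (z ≟ a) (z ≟ b)
  where
  go : Dec (z ≡ a) → Dec (z ≡ b) → swap a b (swap a b z) ≡ z
  go (yes refl) _ = trans (cong (swap a b) (swap-first a b)) (swap-second a b)
  go (no _) (yes refl) = trans (cong (swap a b) (swap-second a b)) (swap-first a b)
  go (no p) (no q) = trans (cong (swap a b) (swap-other a b p q)) (swap-other a b p q)

-- One transposition per argument: it moves the current value at `N` to v N, and it leaves the
-- earlier values alone because they differ from both by injectivity.
extendInjection : ∀ N (v : ℕ → ℕ) → (∀ i j → i < N → j < N → v i ≡ v j → i ≡ j) →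
                  ∃ λ ρ → ∀ i → i < N → to ρ i ≡ v i
extendInjection zero v inj = identity , λ i ()
extendInjection (suc N) v inj with extendInjection N v (λ i j i<N j<N → inj i j (m≤n⇒m≤1+n i<N) (m≤n⇒m≤1+n j<N))
... | ρ , agree = record
  { to = swap a b ∘ to ρ ; from = from ρ ∘ swap a b
  ; from-to = λ x → trans (cong (from ρ) (swap-involutive a b (to ρ x))) (from-to ρ x)
  ; to-from = λ y → trans (cong (swap a b) (to-from ρ (swap a b y))) (swap-involutive a b y) } , agree′
  where
  a b : ℕ
  a = to ρ N
  b = v N
  agree′ : ∀ i → i < suc N → swap a b (to ρ i) ≡ v i
  agree′ i i<1+N with m≤n⇒m<n∨m≡n (s≤s⁻¹ i<1+N)
  ... | inj₂ refl = swap-first a b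
  ... | inj₁ i<N = trans (swap-other a b (λ e → <⇒≢ i<N (to-injective ρ e))
                     (λ e → <⇒≢ i<N (inj i N i<1+N ≤-refl (trans (sym (agree i i<N)) e))))
                     (agree i i<N)

Frequent : (ℕ → Set) → Set
Frequent P = ∀ m → ∃ λ x → m ≤ x × P x

module Pullback (B : Str) (isB : IsBA B) where

  pull : Perm → Str
  pull π = record
    { join = λ x y → from π (join B (to π x) (to π y))
    ; meet = λ x y → from π (meet B (to π x) (to π y))
    ; compl = λ x → from π (compl B (to π x))
    ; top = from π (top B)
    ; bot = from π (bot B) }

  pull-iso : ∀ π → IsIso (pull π) B (to π) (from π)
  pull-iso π = record
    { left = from-to π ; right = to-from π
    ; pres-join = λ _ _ → to-from π _ ; pres-meet = λ _ _ → to-from π _ ; pres-compl = λ _ → to-from π _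
    ; pres-top = to-from π _ ; pres-bot = to-from π _ }

  record IsHom (σ : ℕ → ℕ) : Set where
    field
      h-meet : ∀ x y → σ (meet B x y) ≡ meet B (σ x) (σ y)
      h-compl : ∀ x → σ (compl B x) ≡ compl B (σ x)
      h-top : σ (top B) ≡ top B
    open Homomorphism isB isB σ h-meet h-compl h-top public

  id-hom : IsHom id
  id-hom = record { h-meet = λ _ _ → refl ; h-compl = λ _ → refl ; h-top = refl }

  -- The diagram only sees the operations on codes, so it does not change below N when
  -- the decoding is composed with an endomorphism there.
  hom-agree : ∀ N π ρ {σ} → IsHom σ → (∀ i → i < N → to ρ i ≡ σ (to π i)) → Agree N (diag (pull π)) (diag (pull ρ))
  hom-agree N π ρ {σ} hom e = agree
    where
    open IsHom hom
    settle : ∀ {r s} → s ≡ σ r → from π r < N → from ρ s ≡ from π r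
    settle {r} {s} s≡ lt = trans (cong (from ρ) (trans s≡ (trans (cong σ (sym (to-from π r))) (sym (e _ lt)))))
                             (from-to ρ (from π r))
    agree : Agree N (diag (pull π)) (diag (pull ρ))
    agree s-join (x ∷ y ∷ []) low = settle (trans (cong₂ (join B) (e x (low zero)) (e y (low (suc zero)))) (sym (hom-join _ _)))
    agree s-meet (x ∷ y ∷ []) low = settle (trans (cong₂ (meet B) (e x (low zero)) (e y (low (suc zero)))) (sym (h-meet _ _)))
    agree s-compl (x ∷ []) low = settle (trans (cong (compl B) (e x (low zero))) (sym (h-compl _)))
    agree s-top [] low = settle (sym h-top)
    agree s-bot [] low = settle (sym hom-bot)

  open Algebra B isB using (quasi)

  atom-side : ∀ {a} → Atom B a → ∀ x → Below B a x ⊎ meet B a x ≡ bot B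
  atom-side {a} (_ , h) x with h (meet B a x) (quasi (a ∷ x ∷ []) [] ((v₀ ⊓ v₁) ⊓ v₀ ≈ v₀ ⊓ v₁) refl)
  ... | inj₁ e = inj₂ e
  ... | inj₂ e = inj₁ e

  -- For atoms a ≠ b, an endomorphism with kernel {⊥ , b} which sends a to a ∨ b: it forgets
  -- whether b belongs to x and puts b in the image exactly when a belongs to x.
  module Merge (a b : ℕ) (a-atom : Atom B a) (b-atom : Atom B b) where

    merge : ℕ → ℕ
    merge x with meet B a x ≟ a
    ... | yes _ = join B x b
    ... | no _ = meet B x (compl B b)

    merge-in : ∀ {x} → Below B a x → merge x ≡ join B x b
    merge-in {x} e with meet B a x ≟ a
    ... | yes _ = refl
    ... | no ¬e = ⊥-elim (¬e e)

    merge-out : ∀ {x} → meet B a x ≡ bot B → merge x ≡ meet B x (compl B b)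
    merge-out {x} e with meet B a x ≟ a
    ... | yes e′ = ⊥-elim (proj₁ a-atom (trans (sym e′) e))
    ... | no _ = refl

    -- On points this is the map sending `b` to `a` and fixing the rest, whose preimage map
    -- preserves all operations; the proof checks the cases according to whether `a` lies below each
    -- argument.
    hom : IsHom merge
    hom = record { h-meet = λ x y → on-meet x y (atom-side a-atom x) (atom-side a-atom y)
                 ; h-compl = λ x → on-compl x (atom-side a-atom x)
                 ; h-top = trans (merge-in (quasi (a ∷ []) [] (v₀ ⊓ 𝟙 ≈ v₀) refl)) (quasi (b ∷ []) [] (𝟙 ⊔ v₀ ≈ 𝟙) refl) }
      where
      on-meet : ∀ x y → Below B a x ⊎ meet B a x ≡ bot B → Below B a y ⊎ meet B a y ≡ bot B →
                merge (meet B x y) ≡ meet B (merge x) (merge y)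
      on-meet x y (inj₁ p) (inj₁ q) = trans
        (merge-in (quasi (a ∷ x ∷ y ∷ []) ((v₀ ⊓ v₁ ≈ v₀) ∷ (v₀ ⊓ v₂ ≈ v₀) ∷ []) (v₀ ⊓ v₁ ⊓ v₂ ≈ v₀) refl p q))
        (trans (quasi (b ∷ x ∷ y ∷ []) [] (v₁ ⊓ v₂ ⊔ v₀ ≈ (v₁ ⊔ v₀) ⊓ (v₂ ⊔ v₀)) refl)
          (sym (cong₂ (meet B) (merge-in p) (merge-in q))))
      on-meet x y (inj₁ p) (inj₂ q) = trans
        (merge-out (quasi (a ∷ x ∷ y ∷ []) ((v₀ ⊓ v₂ ≈ 𝟘) ∷ []) (v₀ ⊓ v₁ ⊓ v₂ ≈ 𝟘) refl q))
        (trans (quasi (b ∷ x ∷ y ∷ []) [] ((v₁ ⊓ v₂) ⊓ ∁ v₀ ≈ (v₁ ⊔ v₀) ⊓ (v₂ ⊓ ∁ v₀)) refl)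
          (sym (cong₂ (meet B) (merge-in p) (merge-out q))))
      on-meet x y (inj₂ p) (inj₁ q) = trans
        (merge-out (quasi (a ∷ x ∷ y ∷ []) ((v₀ ⊓ v₁ ≈ 𝟘) ∷ []) (v₀ ⊓ v₁ ⊓ v₂ ≈ 𝟘) refl p))
        (trans (quasi (b ∷ x ∷ y ∷ []) [] ((v₁ ⊓ v₂) ⊓ ∁ v₀ ≈ (v₁ ⊓ ∁ v₀) ⊓ (v₂ ⊔ v₀)) refl)
          (sym (cong₂ (meet B) (merge-out p) (merge-in q))))
      on-meet x y (inj₂ p) (inj₂ q) = trans
        (merge-out (quasi (a ∷ x ∷ y ∷ []) ((v₀ ⊓ v₁ ≈ 𝟘) ∷ []) (v₀ ⊓ v₁ ⊓ v₂ ≈ 𝟘) refl p))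
        (trans (quasi (b ∷ x ∷ y ∷ []) [] ((v₁ ⊓ v₂) ⊓ ∁ v₀ ≈ (v₁ ⊓ ∁ v₀) ⊓ (v₂ ⊓ ∁ v₀)) refl)
          (sym (cong₂ (meet B) (merge-out p) (merge-out q))))
      on-compl : ∀ x → Below B a x ⊎ meet B a x ≡ bot B → merge (compl B x) ≡ compl B (merge x)
      on-compl x (inj₁ p) = trans
        (merge-out (quasi (a ∷ x ∷ []) ((v₀ ⊓ v₁ ≈ v₀) ∷ []) (v₀ ⊓ ∁ v₁ ≈ 𝟘) refl p))
        (trans (quasi (b ∷ x ∷ []) [] (∁ v₁ ⊓ ∁ v₀ ≈ ∁ (v₁ ⊔ v₀)) refl) (sym (cong (compl B) (merge-in p))))
      on-compl x (inj₂ p) = trans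
        (merge-in (quasi (a ∷ x ∷ []) ((v₀ ⊓ v₁ ≈ 𝟘) ∷ []) (v₀ ⊓ ∁ v₁ ≈ v₀) refl p))
        (trans (quasi (b ∷ x ∷ []) [] (∁ v₁ ⊔ v₀ ≈ ∁ (v₁ ⊓ ∁ v₀)) refl) (sym (cong (compl B) (merge-out p))))

    differences : ∀ x y → merge x ≡ merge y → Below B (meet B x (compl B y)) b
    differences x y = go (atom-side a-atom x) (atom-side a-atom y)
      where
      go : Below B a x ⊎ meet B a x ≡ bot B → Below B a y ⊎ meet B a y ≡ bot B → merge x ≡ merge y →
           Below B (meet B x (compl B y)) b
      go (inj₁ p) (inj₁ q) e = quasi (b ∷ x ∷ y ∷ []) ((v₁ ⊔ v₀ ≈ v₂ ⊔ v₀) ∷ []) ((v₁ ⊓ ∁ v₂) ⊓ v₀ ≈ v₁ ⊓ ∁ v₂) refl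
        (trans (sym (merge-in p)) (trans e (merge-in q)))
      go (inj₁ p) (inj₂ q) e = quasi (b ∷ x ∷ y ∷ []) ((v₁ ⊔ v₀ ≈ v₂ ⊓ ∁ v₀) ∷ []) ((v₁ ⊓ ∁ v₂) ⊓ v₀ ≈ v₁ ⊓ ∁ v₂) refl
        (trans (sym (merge-in p)) (trans e (merge-out q)))
      go (inj₂ p) (inj₁ q) e = quasi (b ∷ x ∷ y ∷ []) ((v₁ ⊓ ∁ v₀ ≈ v₂ ⊔ v₀) ∷ []) ((v₁ ⊓ ∁ v₂) ⊓ v₀ ≈ v₁ ⊓ ∁ v₂) refl
        (trans (sym (merge-out p)) (trans e (merge-in q)))
      go (inj₂ p) (inj₂ q) e = quasi (b ∷ x ∷ y ∷ []) ((v₁ ⊓ ∁ v₀ ≈ v₂ ⊓ ∁ v₀) ∷ []) ((v₁ ⊓ ∁ v₂) ⊓ v₀ ≈ v₁ ⊓ ∁ v₂) refl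
        (trans (sym (merge-out p)) (trans e (merge-out q)))

    -- Two elements with the same image differ at most by `b`. Finitely many elements have finitely
    -- many differences, so the hypotheses hold for all of them once `b` is large.
    merge-injective : ∀ x y → meet B x (compl B y) ≢ b → meet B y (compl B x) ≢ b → merge x ≡ merge y → x ≡ y
    merge-injective x y p q e = quasi (x ∷ y ∷ []) ((v₀ ⊓ ∁ v₁ ≈ 𝟘) ∷ (v₁ ⊓ ∁ v₀ ≈ 𝟘) ∷ []) (v₀ ≈ v₁) refl
      (vanish p (differences x y e)) (vanish q (differences y x (sym e)))
      where
      vanish : ∀ {z} → z ≢ b → Below B z b → z ≡ bot B
      vanish {z} z≢b z≤b with proj₂ b-atom z z≤b
      ... | inj₁ e = e
      ... | inj₂ e = ⊥-elim (z≢b e)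

    -- An element that treats `a` and `b` alike is unchanged, so the merge respects the part of the
    -- copy that is already fixed.
    merge-fixes : ∀ x → (Below B a x → Below B b x) → (Below B b x → Below B a x) → merge x ≡ x
    merge-fixes x f g with atom-side a-atom x | atom-side b-atom x
    ... | inj₁ p | _ = trans (merge-in p) (quasi (b ∷ x ∷ []) ((v₀ ⊓ v₁ ≈ v₀) ∷ []) (v₁ ⊔ v₀ ≈ v₁) refl (f p))
    ... | inj₂ p | inj₂ q = trans (merge-out p) (quasi (b ∷ x ∷ []) ((v₀ ⊓ v₁ ≈ 𝟘) ∷ []) (v₁ ⊓ ∁ v₀ ≈ v₁) refl q)
    ... | inj₂ p | inj₁ q = ⊥-elim (proj₁ a-atom (trans (sym (g q)) p))

    merge-nonatom : a ≢ b → ¬ Atom B (merge a)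
    merge-nonatom a≢b (_ , h) with h a (subst (Below B a) (sym (merge-in a≤a)) (quasi (a ∷ b ∷ []) [] (v₀ ⊓ (v₀ ⊔ v₁) ≈ v₀) refl))
      where
      a≤a : Below B a a
      a≤a = quasi (a ∷ []) [] (v₀ ⊓ v₀ ≈ v₀) refl
    ... | inj₁ e = proj₁ a-atom e
    ... | inj₂ e with proj₂ a-atom b (quasi (a ∷ b ∷ []) ((v₀ ≈ v₀ ⊔ v₁) ∷ []) (v₁ ⊓ v₀ ≈ v₁) refl
                        (trans e (merge-in (quasi (a ∷ []) [] (v₀ ⊓ v₀ ≈ v₀) refl))))
    ... | inj₁ e′ = proj₁ b-atom e′
    ... | inj₂ e′ = a≢b (sym e′)

-- The generic copy

module Generic (em : ExcludedMiddle 0ℓ) (B : Str) (isB : IsBA B) where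
  open Pullback B isB
  open Algebra B isB using (quasi)

  rare : ∀ {P : ℕ → Set} → ¬ Frequent P → ∃ λ m → ∀ x → m ≤ x → ¬ P x
  rare {P} ¬freq with em {∃ λ m → ∀ x → m ≤ x → ¬ P x}
  ... | yes h = h
  ... | no ¬h = ⊥-elim (¬freq λ m → late m em)
    where
    late : ∀ m → Dec (∃ λ x → m ≤ x × P x) → ∃ λ x → m ≤ x × P x
    late m (yes h) = h
    late m (no h) = ⊥-elim (¬h (m , λ x m≤x px → h (x , m≤x , px)))

  dichotomy : ∀ {P : ℕ → Set} (Q : ℕ → Set) → Frequent P → Frequent (λ x → P x × Q x) ⊎ Frequent (λ x → P x × ¬ Q x)
  dichotomy {P} Q freq with em {Frequent (λ x → P x × Q x)}
  ... | yes h = inj₁ h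
  ... | no h with rare h
  ... | m , none = inj₂ λ m′ → case freq (m + m′) of λ
    { (x , le , px) → x , ≤-trans (m≤n+m m′ m) le , px , λ qx → none x (≤-trans (m≤m+n m m′) le) (px , qx) }

  -- Pigeonhole, one predicate at a time: one of the two halves of an infinite set is infinite, and
  -- it is kept.
  homogeneous : ∀ {P : ℕ → Set} n (Q : ℕ → ℕ → Set) → Frequent P →
                ∃ λ (P′ : ℕ → Set) → Frequent P′ × (∀ x → P′ x → P x) ×
                  (∀ x y → P′ x → P′ y → ∀ i → i < n → Q i x → Q i y)
  homogeneous {P} zero Q freq = P , freq , (λ _ → id) , λ _ _ _ _ i ()
  homogeneous (suc n) Q freq with homogeneous n Q freq
  ... | P′ , freq′ , sub , hom with dichotomy (Q n) freq′
  ... | inj₁ f = _ , f , (λ x (p , _) → sub x p) , λ x y (px , qx) (py , qy) i i<1+n →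
    case m≤n⇒m<n∨m≡n (s≤s⁻¹ i<1+n) of λ
      { (inj₁ i<n) → hom x y px py i i<n ; (inj₂ refl) → λ _ → qy }
  ... | inj₂ f = _ , f , (λ x (p , _) → sub x p) , λ x y (px , ¬qx) (py , ¬qy) i i<1+n →
    case m≤n⇒m<n∨m≡n (s≤s⁻¹ i<1+n) of λ
      { (inj₁ i<n) → hom x y px py i i<n ; (inj₂ refl) → λ q → ⊥-elim (¬qx q) }

  Extends : ℕ → Perm → Perm → Set
  Extends n π ρ = ∀ i → i < n → to ρ i ≡ to π i

  Halts : MuR BASym 1 → Perm → ℕ → ℕ → Set
  Halts t π c y = _⇓_ (diag (pull π)) (t , c ∷ []) y

  Defeated : MuR BASym 1 → Perm → Set
  Defeated t ρ = ∀ f g → IsIso (pull ρ) B f g → ¬ (∀ x → Halts t ρ x (f x))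

  -- A condition is a finite injection, represented by a total permutation of which only the first
  -- `n` values count; the total permutation provides an actual copy on which a program can be run.
  Forces : MuR BASym 1 → Perm → ℕ → Set
  Forces t π n = ∀ ρ → Extends n π ρ → Defeated t ρ

  module _ (manyAtoms : Frequent (Atom B)) where

    -- The code c of an atom a outside everything decided so far is a test input: if some permitted copy
    -- makes t output an atom there, then merging into a an atom b of the same type moves a to a non-atom
    -- without the computation noticing.
    defeat : ∀ t π n → ∃ λ π′ → ∃ λ n′ → n ≤ n′ × Extends n π π′ × Forces t π′ n′
    defeat t π n with homogeneous n (λ i x → Below B x (to π i)) manyAtoms
    -- Freshness of the atom need not be requested: if it were to π i for some i < n, homogeneity
    -- would put every other atom in `P` below it.
    ... | P , freq , P-atom , alike = with-atom (freq 0)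
      where
      with-atom : (∃ λ a → 0 ≤ a × P a) → ∃ λ π′ → ∃ λ n′ → n ≤ n′ × Extends n π π′ × Forces t π′ n′
      with-atom (a , _ , pa) = decide em
        where
        a-atom : Atom B a
        a-atom = P-atom a pa
        c n₁ : ℕ
        c = from π a
        n₁ = n + suc c
        n≤n₁ : n ≤ n₁
        n≤n₁ = m≤m+n n _
        c<n₁ : c < n₁
        c<n₁ = m≤n+m (suc c) n

        decide : Dec (∃ λ π′ → ∃ λ y → Extends n₁ π π′ × Halts t π′ c y) →
                 ∃ λ π′ → ∃ λ n′ → n ≤ n′ × Extends n π π′ × Forces t π′ n′
        -- No permitted copy makes the program halt on `c`, so in none of them does it compute a
        -- total function.
        decide (no none) = π , n₁ , n≤n₁ , (λ _ _ → refl) , λ ρ ext f g iso halts → none (ρ , f c , ext , halts c)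
        decide (yes (π′ , y , ext′ , halt)) = output em (use (diag (pull π′)) halt)
          where
          to-c : to π′ c ≡ a
          to-c = trans (ext′ c c<n₁) (to-from π a)

          output : Dec (Atom B y) → (∃ λ N → ∀ (σ′ : Interp BASym) → Agree N (diag (pull π′)) σ′ → _⇓_ σ′ (t , c ∷ []) y) →
                   ∃ λ π″ → ∃ λ n′ → n ≤ n′ × Extends n π π″ × Forces t π″ n′
          -- Freezing the code `c` and the use of the computation is enough: `c` goes on coding the
          -- atom `a` while the output stays a non-atom.
          output (no y-nonatom) (N , u) = π′ , n₁ + N , ≤-trans n≤n₁ (m≤m+n n₁ N) ,
            (λ i i<n → ext′ i (≤-trans i<n n≤n₁)) , forced
            where
            forced : Forces t π′ (n₁ + N)
            forced ρ ext f g iso halts = y-nonatom (subst (Atom B) fc≡y (Transfer.atom-image iso c-atom))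
              where
              fc≡y : f c ≡ y
              fc≡y = deterministic (diag (pull ρ)) (halts c)
                (u (diag (pull ρ)) (hom-agree N π′ ρ id-hom λ i i<N → ext i (≤-trans i<N (m≤n+m N n₁))))
              c-atom : Atom (pull ρ) c
              c-atom = subst (Atom (pull ρ))
                (trans (cong (from ρ) (sym (trans (ext c (≤-trans c<n₁ (m≤m+n n₁ N))) to-c))) (from-to ρ c))
                (Transfer.atom-image (IsIso-sym (pull-iso ρ)) a-atom)
          output (yes y-atom) (N , u) = with-second (freq bound)
            where
            n₂ : ℕ
            n₂ = n₁ + N
            gap : ℕ → ℕ → ℕ
            gap i j = meet B (to π′ i) (compl B (to π′ j))
            -- Exceeds `a`, which makes `b` a different atom, and every difference of two decided
            -- elements, which makes the merge injective on them.
            bound : ℕ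
            bound = suc (a + sumBelow (λ i → sumBelow (gap i) n₂) n₂)

            with-second : (∃ λ b → bound ≤ b × P b) → ∃ λ π″ → ∃ λ n′ → n ≤ n′ × Extends n π π″ × Forces t π″ n′
            with-second (b , bound≤b , pb) = π″ , n₂ , ≤-trans n≤n₁ (m≤m+n n₁ N) , ext″ , forced
              where
              b-atom : Atom B b
              b-atom = P-atom b pb
              open Merge a b a-atom b-atom

              a≢b : a ≢ b
              a≢b = <⇒≢ (≤-trans (s≤s (m≤m+n a _)) bound≤b)

              gap≢b : ∀ i j → i < n₂ → j < n₂ → gap i j ≢ b
              gap≢b i j i<n₂ j<n₂ = <⇒≢ (≤-trans (s≤s (≤-trans (≤-sumBelow (gap i) n₂ j<n₂)
                (≤-trans (≤-sumBelow (λ i → sumBelow (gap i) n₂) n₂ i<n₂) (m≤n+m _ a)))) bound≤b)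

              extension : ∃ λ ρ → ∀ i → i < n₂ → to ρ i ≡ merge (to π′ i)
              extension = extendInjection n₂ (merge ∘ to π′) λ i j i<n₂ j<n₂ e → to-injective π′
                (merge-injective _ _ (gap≢b i j i<n₂ j<n₂) (gap≢b j i j<n₂ i<n₂) e)

              π″ : Perm
              π″ = proj₁ extension

              ext″ : Extends n π π″
              ext″ i i<n = trans (proj₂ extension i (≤-trans i<n (≤-trans n≤n₁ (m≤m+n n₁ N))))
                (trans (cong merge (ext′ i (≤-trans i<n n≤n₁)))
                  (merge-fixes (to π i) (alike a b pa pb i i<n) (alike b a pb pa i i<n)))

              forced : Forces t π″ n₂
              forced ρ ext f g iso halts = merge-nonatom a≢b (subst (Atom B)
                (trans (to-ρ c (≤-trans c<n₁ (m≤m+n n₁ N))) (cong merge to-c))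
                (Transfer.atom-image (pull-iso ρ) c-atom))
                where
                to-ρ : ∀ i → i < n₂ → to ρ i ≡ merge (to π′ i)
                to-ρ i i<n₂ = trans (ext i i<n₂) (proj₂ extension i i<n₂)
                fc≡y : f c ≡ y
                fc≡y = deterministic (diag (pull ρ)) (halts c)
                  (u (diag (pull ρ)) (hom-agree N π′ ρ hom λ i i<N → to-ρ i (≤-trans i<N (m≤n+m N n₁))))
                c-atom : Atom (pull ρ) c
                c-atom = subst (Atom (pull ρ)) (trans (cong g (sym fc≡y)) (IsIso.left iso c))
                  (Transfer.atom-image (IsIso-sym iso) y-atom)

    defeatAll : ∀ ts π n → ∃ λ π′ → ∃ λ n′ → n ≤ n′ × Extends n π π′ × (∀ t → t ∈ ts → Forces t π′ n′)
    defeatAll [] π n = π , n , ≤-refl , (λ _ _ → refl) , λ t ()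
    defeatAll (t ∷ ts) π n with defeat t π n
    ... | π₁ , n₁ , n≤n₁ , ext₁ , forced₁ with defeatAll ts π₁ n₁
    ... | π₂ , n₂ , n₁≤n₂ , ext₂ , forced₂ = π₂ , n₂ , ≤-trans n≤n₁ n₁≤n₂ ,
      (λ i i<n → trans (ext₂ i (≤-trans i<n n≤n₁)) (ext₁ i i<n)) ,
      λ { _ (here refl) ρ ext → forced₁ ρ λ i i<n₁ → trans (ext i (≤-trans i<n₁ n₁≤n₂)) (ext₂ i i<n₁)
        ; s (there s∈) → forced₂ s s∈ }

    record Stage : Set where
      constructor stage
      field
        perm : Perm
        len  : ℕ
    open Stage

    advance : ℕ → Stage → Stage
    advance s (stage π n) with defeatAll (programs s 1) π n
    -- The added length fixes the value at `s` and also the code of `s`, so that the limit is total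
    -- and surjective.
    ... | π′ , n′ , _ = stage π′ (n′ + (suc s + suc (from π′ s)))

    advance-extends : ∀ s S → len S ≤ len (advance s S) × Extends (len S) (perm S) (perm (advance s S))
    advance-extends s (stage π n) with defeatAll (programs s 1) π n
    ... | π′ , n′ , n≤n′ , ext , _ = ≤-trans n≤n′ (m≤m+n n′ _) , ext

    advance-forces : ∀ s S t → t ∈ programs s 1 → Forces t (perm (advance s S)) (len (advance s S))
    advance-forces s (stage π n) t t∈ with defeatAll (programs s 1) π n
    ... | π′ , n′ , _ , _ , forced = λ ρ ext → forced t t∈ ρ λ i i<n′ → ext i (≤-trans i<n′ (m≤m+n n′ _))

    advance-long : ∀ s S → s < len (advance s S) × from (perm (advance s S)) s < len (advance s S)
    advance-long s (stage π n) with defeatAll (programs s 1) π n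
    ... | π′ , n′ , _ = ≤-trans (m≤m+n (suc s) _) (m≤n+m _ n′) , ≤-trans (m≤n+m _ (suc s)) (m≤n+m _ n′)

    stages : ℕ → Stage
    stages zero = stage identity 0
    stages (suc s) = advance s (stages s)

    stages-extend : ∀ {s r} → s ≤′ r → len (stages s) ≤ len (stages r) ×
                    Extends (len (stages s)) (perm (stages s)) (perm (stages r))
    stages-extend ≤′-refl = ≤-refl , λ _ _ → refl
    stages-extend {s} {suc r} (≤′-step s≤r) with stages-extend s≤r | advance-extends r (stages r)
    ... | le , ext | le′ , ext′ = ≤-trans le le′ , λ i i< → trans (ext′ i (≤-trans i< le)) (ext i i<)

    -- The value at `i` is read at stage suc i, whose length already exceeds `i`, so no later stage
    -- changes it.
    limit-to : ℕ → ℕ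
    limit-to i = to (perm (stages (suc i))) i

    limit-extends : ∀ s i → i < len (stages s) → limit-to i ≡ to (perm (stages s)) i
    limit-extends s i i< with ≤-total s (suc i)
    ... | inj₁ s≤i = proj₂ (stages-extend (≤⇒≤′ s≤i)) i i<
    ... | inj₂ i≤s = sym (proj₂ (stages-extend (≤⇒≤′ i≤s)) i (proj₁ (advance-long i (stages i))))

    limit-injective : ∀ i j → limit-to i ≡ limit-to j → i ≡ j
    limit-injective i j e = to-injective (perm (stages s)) (trans (sym (limit-extends s i i<)) (trans e (limit-extends s j j<)))
      where
      s : ℕ
      s = suc i + suc j
      i< : i < len (stages s)
      i< = ≤-trans (proj₁ (advance-long i (stages i))) (proj₁ (stages-extend {suc i} {s} (≤⇒≤′ (m≤m+n (suc i) _))))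
      j< : j < len (stages s)
      j< = ≤-trans (proj₁ (advance-long j (stages j))) (proj₁ (stages-extend {suc j} {s} (≤⇒≤′ (m≤n+m (suc j) (suc i)))))

    limit-from : ℕ → ℕ
    limit-from j = from (perm (stages (suc j))) j

    limit-to-from : ∀ j → limit-to (limit-from j) ≡ j
    limit-to-from j = trans (limit-extends (suc j) _ (proj₂ (advance-long j (stages j)))) (to-from (perm (stages (suc j))) j)

    limit : Perm
    limit = record { to = limit-to ; from = limit-from
                   ; from-to = λ x → limit-injective _ _ (limit-to-from (limit-to x)) ; to-from = limit-to-from }

    limit-defeats : ∀ t → Defeated t limit
    limit-defeats t with listed t
    ... | d , t∈ = advance-forces d (stages d) t (t∈ d ≤-refl) limit (limit-extends (suc d))

    ¬relCompCat : ¬ RelCompCat B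
    ¬relCompCat rcc with rcc (pull limit) (_ , _ , pull-iso limit)
    ... | f , g , iso , t , halts = limit-defeats t f g iso halts

  -- Infinite algebras with boundedly many atoms

  Unbounded : ℕ → Set
  Unbounded w = Frequent (λ x → Below B x w)

  -- An element x is y or y ∨ a, where y is its part off the atom. So bounded y would bound x; the
  -- sum in the proof dominates both possibilities for all y < N.
  unbounded-minus-atom : ∀ {w a} → Atom B a → Unbounded w → Unbounded (meet B w (compl B a))
  unbounded-minus-atom {w} {a} a-atom inf N with inf (sumBelow (λ y → suc (y + join B y a)) N)
  ... | x , M≤x , x≤w with <-≤-connex (meet B x (compl B a)) N
  ... | inj₂ N≤y = meet B x (compl B a) , N≤y ,
        quasi (x ∷ w ∷ a ∷ []) ((v₀ ⊓ v₁ ≈ v₀) ∷ []) ((v₀ ⊓ ∁ v₂) ⊓ (v₁ ⊓ ∁ v₂) ≈ v₀ ⊓ ∁ v₂) refl x≤w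
  ... | inj₁ y<N = ⊥-elim (<-irrefl refl (≤-trans (small (atom-side a-atom x)) (≤-trans (≤-sumBelow _ N y<N) M≤x)))
    where
    y : ℕ
    y = meet B x (compl B a)
    small : Below B a x ⊎ meet B a x ≡ bot B → suc x ≤ suc (y + join B y a)
    small (inj₁ p) = s≤s (≤-trans (≤-reflexive
      (quasi (x ∷ a ∷ []) ((v₁ ⊓ v₀ ≈ v₁) ∷ []) (v₀ ≈ v₀ ⊓ ∁ v₁ ⊔ v₁) refl p)) (m≤n+m _ y))
    small (inj₂ p) = s≤s (≤-trans (≤-reflexive
      (quasi (x ∷ a ∷ []) ((v₁ ⊓ v₀ ≈ 𝟘) ∷ []) (v₀ ≈ v₀ ⊓ ∁ v₁) refl p)) (m≤m+n y _))

  boundedAtoms⇒rank : ∀ {m} → (∀ x → m ≤ x → ¬ Atom B x) → ∃ (AtomicRank B (top B))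
  boundedAtoms⇒rank {m} none = go m 0 (≤-reflexive (sym (+-identityʳ m))) (top B)
    -- The algebra is infinite because every natural number is an element; this starts the invariant
    -- that keeps the remainder nonzero.
    (λ N → N , ≤-refl , quasi (N ∷ []) [] (v₀ ⊓ 𝟙 ≈ v₀) refl) (λ _ _ _ → z≤n)
    where
    -- The candidates j = 0, 1, ... are tested for being atoms below the current remainder, from
    -- which all smaller atoms have been removed; `d` counts the tests left before the bound m is
    -- reached.
    go : ∀ d j → m ≤ d + j → ∀ w → Unbounded w → (∀ a → Atom B a → Below B a w → j ≤ a) → ∃ (AtomicRank B w)
    go zero j m≤j w inf above = 0 , atomless w≢⊥ λ x x≤w x≢⊥ → between x x≤w x≢⊥ em
      where
      w≢⊥ : w ≢ bot B
      w≢⊥ refl with inf (suc (bot B))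
      ... | x , ⊥<x , x≤⊥ = <⇒≢ ⊥<x (sym (quasi (x ∷ []) ((v₀ ⊓ 𝟘 ≈ v₀) ∷ []) (v₀ ≈ 𝟘) refl x≤⊥))
      between : ∀ x → Below B x w → x ≢ bot B → Dec (∃ λ z → Between B z x) → ∃ λ z → Between B z x
      between x x≤w x≢⊥ (yes h) = h
      -- An unsplittable `x` would be an atom below the remainder, hence at least j and so beyond
      -- the bound on atoms.
      between x x≤w x≢⊥ (no h) = ⊥-elim (none x (≤-trans m≤j (above x x-atom x≤w)) x-atom)
        where
        x-atom : Atom B x
        x-atom = x≢⊥ , λ z z≤x → side z z≤x (z ≟ bot B) (z ≟ x)
          where
          side : ∀ z → Below B z x → Dec (z ≡ bot B) → Dec (z ≡ x) → z ≡ bot B ⊎ z ≡ x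
          side z z≤x (yes e) _ = inj₁ e
          side z z≤x (no _) (yes e) = inj₂ e
          side z z≤x (no p) (no q) = ⊥-elim (h (z , z≤x , p , q))
    go (suc d) j m≤d+j w inf above with em {Atom B j × Below B j w}
    ... | no h = go d (suc j) (≤-trans m≤d+j (≤-reflexive (sym (+-suc d j)))) w inf λ a at a≤w →
      case m≤n⇒m<n∨m≡n (above a at a≤w) of λ { (inj₁ lt) → lt ; (inj₂ refl) → ⊥-elim (h (at , a≤w)) }
    ... | yes (j-atom , j≤w) with go d (suc j) (≤-trans m≤d+j (≤-reflexive (sym (+-suc d j)))) (meet B w (compl B j))
        (unbounded-minus-atom j-atom inf) next
      where
      next : ∀ a → Atom B a → Below B a (meet B w (compl B j)) → suc j ≤ a
      next a at a≤ with m≤n⇒m<n∨m≡n (above a at (quasi (a ∷ w ∷ j ∷ []) ((v₀ ⊓ (v₁ ⊓ ∁ v₂) ≈ v₀) ∷ []) (v₀ ⊓ v₁ ≈ v₀) refl a≤))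
      ... | inj₁ lt = lt
      ... | inj₂ refl = ⊥-elim (proj₁ at (quasi (a ∷ w ∷ []) ((v₀ ⊓ (v₁ ⊓ ∁ v₀) ≈ v₀) ∷ []) (v₀ ≈ 𝟘) refl a≤))
    ... | n , rank = suc n , splitAtom j
      (subst (Atom B) (quasi (j ∷ w ∷ []) ((v₀ ⊓ v₁ ≈ v₀) ∷ []) (v₀ ≈ v₁ ⊓ v₀) refl j≤w) j-atom) rank

  relCompCat⇒rank : RelCompCat B → ∃ (AtomicRank B (top B))
  relCompCat⇒rank rcc with em {Frequent (Atom B)}
  ... | yes freq = ⊥-elim (¬relCompCat freq rcc)
  ... | no h = boundedAtoms⇒rank (proj₂ (rare h))

theorem4p2 : ExcludedMiddle 0ℓ → (B : Str) → IsBA B → Punctual B → RelCompCat B →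
    (d : ℕ → ℕ) → InPrCat B d ⇔ InCone d
theorem4p2 em B isB _ rcc d = mk⇔
  (prCat⇒cone isB (proj₂ (Generic.relCompCat⇒rank em B isB rcc)))
  (cone⇒prCat {B} {d} rcc)
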